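{- Let $n$ and $k$ be positive integers with $k\le n$, and let $m$ be a nonnegative integer. Consider an airplane with $n$ seats numbered $1,\dots,n$ and $n$ passengers numbered $1,\dots,n$, passenger $i$ being assigned seat $i$. Passengers board one at a time in the order $1,2,\dots,n$. Passengers $1,\dots,k$ are absent-minded: when it is such a passenger's turn, he chooses a seat uniformly at random among the currently unoccupied seats. Each passenger $i>k$ sits in seat $i$ if it is unoccupied, and otherwise chooses a seat uniformly at random among the currently unoccupied seats. Call a passenger misseated if he does not end up in his assigned seat. Then the probability $P_{n,k}(m)$ that exactly $m$ passengers are misseated is \[ P_{n,k}(m)=\frac{(-1)^m(n-k)!}{n!}\binom{k}{m}+\frac{1}{n!}\sum_{s=1}^{k}\left[{n-k+1 \atop m-s+1}\right]\binom{k}{s}\, s!\sum_{\ell=1}^{s}\frac{(-1)^{s-\ell}\,\ell^{m-s}}{(s-\ell)!}. \]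
   Context: Here $\left[{i \atop j}\right]$ denotes the unsigned Stirling number of the first kind (the number of permutations of $i$ elements with exactly $j$ disjoint cycles), with the conventions $\left[{p \atop 0}\right]=0$ and $\left[{p \atop -q}\right]=0$ for positive integers $p,q$. The binomial coefficient $\binom{k}{m}$ is interpreted as $0$ when $m>k$. -}

module Defs where

open import Algebra.Definitions.RawMonoid using () renaming (sum to monoidSum)
open import Algebra.Definitions.RawSemiring using () renaming (_^_ to semiringPower)
open import Data.Bool.Base using (if_then_else_)
open import Data.Bool.Properties using () renaming (_≟_ to _≟ᵇ_)
open import Data.Fin.Base using (Fin; toℕ)
open import Data.Fin.Properties using (any?) renaming (_≟_ to _≟ᶠ_)
open import Data.Fin.Subset using (Subset)
open import Data.Integer.Base using (ℤ; +_; -[1+_])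
open import Data.Integer.Properties using () renaming (_≟_ to _≟ᶻ_)
open import Data.List.Base
  using (List; []; _∷_; [_]; map; concatMap; filter; length; foldr; allFin;
         cartesianProductWith; deduplicate)
open import Data.List.Membership.DecPropositional using (_∈?_)
open import Data.Nat.Base using (ℕ; zero; suc; NonZero; _!)
open import Data.Nat.Base using () renaming (_^_ to _^ⁿ_)
open import Data.Nat.Properties using (_<?_; _!≢0; m^n≢0) renaming (_≟_ to _≟ⁿ_)
open import Data.Product.Base using (_×_; _,_; proj₁; proj₂)
open import Data.Rational.Base
  using (ℚ; 0ℚ; 1ℚ; _+_; _*_; _/_; +-0-rawMonoid; +-*-rawSemiring)
open import Data.Vec.Base using (Vec; lookup; tabulate) renaming ([] to []ᵛ; _∷_ to _∷ᵛ_)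
open import Data.Vec.Properties using (≡-dec)
import Data.Vec.Relation.Unary.AllPairs as AllPairs
open import Data.Nat.GeneralisedArithmetic using (iterate)
open import Level using (Level)
open import Relation.Binary.PropositionalEquality.Core using (_≡_)
open import Relation.Nullary.Decidable.Core using (does; ¬?)
open import Relation.Unary using (Pred; Decidable)

private variable
  a b p : Level
  A : Set a
  B : Set b

infixr 8 _^_ _^ᶻ_
infixl 7 _/!_
infixl 1 _>>=_

fromℕ : ℕ → ℚ
fromℕ n = + n / 1

_^_ : ℚ → ℕ → ℚ
_^_ = semiringPower +-*-rawSemiring

_^ᶻ_ : (ℓ : ℕ) → .{{NonZero ℓ}} → ℤ → ℚ
ℓ ^ᶻ (+ e)    = fromℕ (ℓ ^ⁿ e)
ℓ ^ᶻ -[1+ e ] = (+ 1 / (ℓ ^ⁿ suc e)) {{m^n≢0 ℓ (suc e)}}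

-- q /! n is q divided by n!.
_/!_ : ℚ → ℕ → ℚ
q /! n = q * (+ 1 / n !) {{n !≢0}}

-- ∑[1≤i≤ n ] f is f 1 + ⋯ + f n; the summand may use that its index is nonzero.
∑[1≤i≤_] : (n : ℕ) → ((i : ℕ) → .{{NonZero i}} → ℚ) → ℚ
∑[1≤i≤ n ] f = monoidSum +-0-rawMonoid {n} (λ i → f (suc (toℕ i)))

words : List A → (k : ℕ) → List (Vec A k)
words xs zero    = [ []ᵛ ]
words xs (suc k) = cartesianProductWith _∷ᵛ_ xs (words xs k)

-- One-line notation: σ sends x to lookup σ x, and its entries are distinct.
permutations : (n : ℕ) → List (Vec (Fin n) n)
permutations n =
  filter (AllPairs.allPairs? (λ x y → ¬? (x ≟ᶠ y))) (words (allFin n) n)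

-- The cycle through x as a set; it has at most n elements, so fewer than n
-- iterations of σ reach all of it.
cycleThrough : ∀ {n} → Vec (Fin n) n → Fin n → Subset n
cycleThrough {n} σ x =
  tabulate λ y → does (any? {n} λ t → iterate (lookup σ) x (toℕ t) ≟ᶠ y)

-- Fixed points count as cycles.
numCycles : ∀ {n} → Vec (Fin n) n → ℕ
numCycles {n} σ =
  length (deduplicate (≡-dec _≟ᵇ_) (map (cycleThrough σ) (allFin n)))

-- Unsigned Stirling number of the first kind, for any integer j.
stirling₁ : ℕ → ℤ → ℕ
stirling₁ i j = length (filter (λ σ → + numCycles σ ≟ᶻ j) (permutations i))

-- Finitely supported distributions: weighted outcomes, possibly repeated.
Dist : Set a → Set a
Dist A = List (ℚ × A)

return : A → Dist A
return x = [ 1ℚ , x ]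

_>>=_ : Dist A → (A → Dist B) → Dist B
d >>= f = concatMap (λ (w , x) → map (λ (v , y) → w * v , y) (f x)) d

-- The empty list, which supports no distribution, gets the zero measure.
uniform : List A → Dist A
uniform []            = []
uniform xs@(_ ∷ xs′) = map (λ x → + 1 / suc (length xs′) , x) xs

Pr : {E : Pred A p} → Decidable E → Dist A → ℚ
Pr E? d = foldr _+_ 0ℚ (map proj₁ (filter (λ wx → E? (proj₂ wx)) d))

-- Seats and passengers are both Fin n, so number i is represented by i - 1 and
-- the absent-minded passengers 1, …, k are those with toℕ i < k.
chooseSeat : ∀ {n} (k : ℕ) (free : List (Fin n)) → Fin n → Dist (Fin n)
chooseSeat k free i =
  if does (toℕ i <? k)          then uniform free
  else if does (_∈?_ _≟ᶠ_ i free) then return i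
  else                               uniform free

-- The outcome lists the pairs (passenger , seat taken) in boarding order.
board : ∀ {n} (k : ℕ) (queue free : List (Fin n)) → Dist (List (Fin n × Fin n))
board k []          free = return []
board k (i ∷ queue) free =
  chooseSeat k free i                                  >>= λ s →
  board k queue (filter (λ t → ¬? (t ≟ᶠ s)) free)      >>= λ rest →
  return ((i , s) ∷ rest)

misseated : ∀ {n} → List (Fin n × Fin n) → ℕ
misseated seating = length (filter (λ (i , s) → ¬? (s ≟ᶠ i)) seating)

P : (n k m : ℕ) → ℚ
P n k m = Pr (λ seating → misseated seating ≟ⁿ m) (board k (allFin n) (allFin n))

-- Let x mark misseated passengers.  When the passengers Q are still to board and
-- the seats F are free, with |Q| = |F|, the generating function of the number of
-- passengers of Q that get misseated, times |F|!, is weight Q 0 F.  The extra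
-- argument h of the weight turns the uniform choice of a seat into a shift:
--   Σ_{s ∈ F} weight Q h (F ∖ s) + (1 + h + |Q|) weight Q h F
--     = weight Q (1 + h) F + |F| weight Q h F.
-- For k absent-minded and r attentive passengers, all of whose seats are free, the
-- weight is (1 + x∇)^k φ, where φ h = h! (1 + hx) ⋯ (r + hx) and
-- ∇φ h = φ (1 + h) - φ h.  Expanding (1 + x∇)^k, then each ∇^s at h = 0, by the
-- binomial theorem gives the double sum: the coefficients of (1 + hx) ⋯ (r + hx)
-- are Stirling numbers times powers of h.

module Submission where

open import Defs
open import Algebra.Bundles using (CommutativeRing)
import Algebra.Properties.Ring
import Algebra.Properties.Semiring.Mult
import Algebra.Solver.Ring.NaturalCoefficients.Default
open import Data.Bool.Base using (Bool; true; false; if_then_else_)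
open import Data.Fin.Base as Fin using (Fin; toℕ)
open import Data.Fin.Properties using () renaming (_≟_ to _≟ᶠ_)
import Data.Integer.Base as ℤ
import Data.Integer.Properties as ℤ
open import Data.List.Base
  using (List; []; _∷_; _++_; foldr; map; filter; length; tabulate; allFin; cartesianProductWith; deduplicate)
open import Data.List.Membership.DecPropositional using (_∈?_)
open import Data.List.Membership.Propositional using (_∈_; _∉_)
open import Data.List.Membership.Propositional.Properties using (∈-filter⁺; ∈-filter⁻; ∈-allFin)
open import Data.List.Properties using (length-++; length-map; length-tabulate; filter-++; filter-all; filter-none)
open import Data.List.Relation.Unary.All as All using (All; []; _∷_)
open import Data.List.Relation.Unary.Any using (here; there)
open import Data.List.Relation.Unary.Unique.Propositional using (Unique; []; _∷_)
import Data.List.Relation.Unary.Unique.Propositional.Properties as Unique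
open import Data.Nat.Base as ℕ using (ℕ; zero; suc; _∸_; _!; NonZero; z≤n; s≤s)
import Data.Nat.DivMod as ℕ
import Data.Nat.Properties as ℕ
import Data.Nat.Solver as ℕ
open import Data.Product.Base using (∃; _,_; proj₁; proj₂)
open import Data.Sum.Base using ([_,_]′)
open import Function.Base using (_∘_; id)
open import Function.Bundles using (_⇔_; mk⇔; Equivalence)
open import Level using (0ℓ)
open import Relation.Binary.PropositionalEquality as ≡ using (_≡_; _≢_)
import Relation.Binary.Reasoning.Setoid
open import Relation.Nullary.Decidable using (Dec; does; yes; no; ¬?; dec-true; dec-false; does-⇔)
open import Relation.Nullary.Negation using (¬_; contradiction)
open import Relation.Unary using (Pred; Decidable)

-- A boarding state is a set of free seats, and a uniform choice averages over all successor sets.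
-- The weight makes this tractable because its recursion never shrinks `F`: it only tests whether
-- the own seats of passengers still to board lie in it. So removing a seat can be felt at one
-- passenger at most, and raising `h` records the total effect. The weight is studied over any
-- commutative ring with `y + x` equal to 1, with cancellation in place of subtraction, so that
-- every identity is one of semirings. Rational power series with `x = X` and `y = 1-X` come in only
-- afterwards. The summand with `k C m` is the term of index 0 in the expansion of ∇^s: φ 0 = r! is
-- constant in x, so it survives only in the coefficient with m = s. The remaining indices ℓ are
-- positive, so ℓ^(m-s) makes sense for m < s as well; there its value is immaterial, since it is
-- multiplied by a Stirling number of nonpositive lower index, which is 0. Stirling numbers are
-- defined here by counting permutations, so their recurrence has to come from a bijection that
-- inserts a new element into the cycles.

_∖_ : ∀ {n} → List (Fin n) → Fin n → List (Fin n)
F ∖ s = filter (λ t → ¬? (t ≟ᶠ s)) F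

∈-∖⁺ : ∀ {n} {F : List (Fin n)} {i s} → i ∈ F → i ≢ s → i ∈ F ∖ s
∈-∖⁺ {s = s} = ∈-filter⁺ (λ t → ¬? (t ≟ᶠ s))

∈-∖⁻ : ∀ {n} (F : List (Fin n)) {i s} → i ∈ F ∖ s → i ∈ F
∈-∖⁻ F {s = s} = proj₁ ∘ ∈-filter⁻ (λ t → ¬? (t ≟ᶠ s)) {xs = F}

∉-∖ : ∀ {n} (F : List (Fin n)) s → s ∉ F ∖ s
∉-∖ F s s∈ = proj₂ (∈-filter⁻ (λ t → ¬? (t ≟ᶠ s)) {xs = F} s∈) ≡.refl

-- The weight of a queue and its sum over the removed seat.

module Weights {c ℓ} (R : CommutativeRing c ℓ)
  (x y : CommutativeRing.Carrier R)
  (y+x≈1 : CommutativeRing._≈_ R (CommutativeRing._+_ R y x) (CommutativeRing.1# R))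
  where

  open CommutativeRing R
  open Algebra.Properties.Ring ring using (+-cancelʳ)
  open Algebra.Properties.Semiring.Mult semiring using (_×_; ×1-homo-*)
  module Solver = Algebra.Solver.Ring.NaturalCoefficients.Default commutativeSemiring
  open Solver using (solve; _:+_; _:*_; _:=_; con)
  open Relation.Binary.Reasoning.Setoid setoid

  ι : ℕ → Carrier
  ι n = n × 1#

  sumOver : ∀ {a} {A : Set a} → List A → (A → Carrier) → Carrier
  sumOver xs f = foldr (λ a r → f a + r) 0# xs

  sumOver-cong : ∀ {a} {A : Set a} {f g : A → Carrier} (xs : List A) →
                 (∀ {s} → s ∈ xs → f s ≈ g s) → sumOver xs f ≈ sumOver xs g
  sumOver-cong []       f≈g = refl
  sumOver-cong (s ∷ xs) f≈g = +-cong (f≈g (here ≡.refl)) (sumOver-cong xs (f≈g ∘ there))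

  sumOver-linear : ∀ {a} {A : Set a} p q (f g : A → Carrier) xs →
    sumOver xs (λ s → p * f s + q * g s) ≈ p * sumOver xs f + q * sumOver xs g
  sumOver-linear p q f g [] = solve 2 (λ p q → con 0 := p :* con 0 :+ q :* con 0) refl p q
  sumOver-linear p q f g (s ∷ xs) = begin
    (p * f s + q * g s) + sumOver xs (λ s → p * f s + q * g s)
      ≈⟨ +-congˡ (sumOver-linear p q f g xs) ⟩
    (p * f s + q * g s) + (p * sumOver xs f + q * sumOver xs g)
      ≈⟨ solve 6 (λ p q a b c d → (p :* a :+ q :* b) :+ (p :* c :+ q :* d)
                                  := p :* (a :+ c) :+ q :* (b :+ d)) refl p q (f s) (g s) _ _ ⟩
    p * (f s + sumOver xs f) + q * (g s + sumOver xs g) ∎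

  sumOver-*ˡ : ∀ {a} {A : Set a} p (f : A → Carrier) xs →
               sumOver xs (λ s → p * f s) ≈ p * sumOver xs f
  sumOver-*ˡ p f []       = sym (zeroʳ p)
  sumOver-*ˡ p f (s ∷ xs) = trans (+-congˡ (sumOver-*ˡ p f xs)) (sym (distribˡ p _ _))

  sumOver-const : ∀ {a} {A : Set a} r (xs : List A) → sumOver xs (λ _ → r) ≈ ι (length xs) * r
  sumOver-const r []       = sym (zeroˡ r)
  sumOver-const r (_ ∷ xs) = begin
    r + sumOver xs (λ _ → r)       ≈⟨ +-congˡ (sumOver-const r xs) ⟩
    r + ι (length xs) * r          ≈⟨ +-congʳ (*-identityˡ r) ⟨
    1# * r + ι (length xs) * r     ≈⟨ distribʳ r 1# _ ⟨
    (1# + ι (length xs)) * r       ∎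

  -- The element `i` occurs exactly once, so the two sums differ in a single summand. Adding the
  -- opposite summand to each side expresses this without subtraction.
  sumOver-exchange : ∀ {a} {A : Set a} {f g : A → Carrier} {i} {xs : List A} →
    Unique xs → i ∈ xs → (∀ {s} → s ∈ xs → s ≢ i → f s ≈ g s) →
    sumOver xs f + g i ≈ sumOver xs g + f i
  sumOver-exchange {f = f} {g} {i} {_ ∷ xs} (i∉ ∷ _) (here ≡.refl) f≈g = begin
    (f i + sumOver xs f) + g i
      ≈⟨ +-congʳ (+-congˡ (sumOver-cong xs λ s∈ → f≈g (there s∈) (All.lookup i∉ s∈ ∘ ≡.sym))) ⟩
    (f i + sumOver xs g) + g i
      ≈⟨ solve 3 (λ a b c → (a :+ b) :+ c := (c :+ b) :+ a) refl (f i) _ (g i) ⟩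
    (g i + sumOver xs g) + f i ∎
  sumOver-exchange {f = f} {g} {i} {s ∷ xs} (s∉ ∷ u) (there i∈) f≈g = begin
    (f s + sumOver xs f) + g i   ≈⟨ +-assoc _ _ _ ⟩
    f s + (sumOver xs f + g i)   ≈⟨ +-cong (f≈g (here ≡.refl) (All.lookup s∉ i∈))
                                           (sumOver-exchange u i∈ (f≈g ∘ there)) ⟩
    g s + (sumOver xs g + f i)   ≈⟨ +-assoc _ _ _ ⟨
    (g s + sumOver xs g) + f i   ∎

  -- Here `c` counts the passengers still to board, the current one included. An absent-minded
  -- passenger gets `y`, that is 1 - x, because the own seat counts 1 where every other seat counts
  -- `x`. For an attentive one, each unit of `h` adds the `x` of finding the own seat taken.
  stay : Bool → ℕ → ℕ → Carrier
  stay true  c h = y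
  stay false c h = ι c + ι h * x

  leave : Bool → Carrier
  leave true  = x
  leave false = 0#

  -- Comparing the coefficients of `weight Q (suc h) F` in the inductive step of `sum-weight` leaves
  -- exactly this condition on the two factors.
  stay-suc : ∀ b c h → stay b c (suc h) + leave b ≈ stay b c h + x
  stay-suc true  c h = refl
  stay-suc false c h = solve 3 (λ c h x → (c :+ (con 1 :+ h) :* x) :+ con 0 := (c :+ h :* x) :+ x)
                         refl (ι c) (ι h) x

  module _ {n : ℕ} (k : ℕ) where

    absent : Fin n → Bool
    absent i = does (toℕ i ℕ.<? k)

    -- The argument h counts the displacements pending from earlier passengers, the
    -- eventual number t of which contributes t !.
    weight : List (Fin n) → ℕ → List (Fin n) → Carrier
    weight []      h F = ι (h !)
    weight (i ∷ Q) h F =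
      if does (_∈?_ _≟ᶠ_ i F)
      then stay (absent i) (suc (length Q)) h * weight Q h F + leave (absent i) * weight Q (suc h) F
      else x * weight Q (suc h) F

    weight-free : ∀ {i} Q h {F} → i ∈ F →
      weight (i ∷ Q) h F ≡ stay (absent i) (suc (length Q)) h * weight Q h F + leave (absent i) * weight Q (suc h) F
    weight-free {i} Q h {F} i∈F rewrite dec-true (_∈?_ _≟ᶠ_ i F) i∈F = ≡.refl

    weight-taken : ∀ {i} Q h {F} → i ∉ F → weight (i ∷ Q) h F ≡ x * weight Q (suc h) F
    weight-taken {i} Q h {F} i∉F rewrite dec-false (_∈?_ _≟ᶠ_ i F) i∉F = ≡.refl

    -- `F` is consulted only about the own seats of the passengers in `Q`.
    weight-cong : ∀ Q h {F F′} → (∀ {i} → i ∈ Q → i ∈ F ⇔ i ∈ F′) → weight Q h F ≡ weight Q h F′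
    weight-cong []      h eq = ≡.refl
    weight-cong (i ∷ Q) h {F} {F′} eq
      rewrite weight-cong Q h {F} {F′} (eq ∘ there) | weight-cong Q (suc h) {F} {F′} (eq ∘ there)
            | does-⇔ (eq (here ≡.refl)) (_∈?_ _≟ᶠ_ i F) (_∈?_ _≟ᶠ_ i F′) = ≡.refl

    weight-∖ : ∀ Q h {F i} → i ∉ Q → weight Q h (F ∖ i) ≡ weight Q h F
    weight-∖ Q h {F} i∉Q = weight-cong Q h λ j∈Q →
      mk⇔ (∈-∖⁻ F) (λ j∈F → ∈-∖⁺ j∈F λ { ≡.refl → i∉Q j∈Q })

    private
      -- The algebra of the inductive step: `T` is the sum for the longer queue, `S₀` and `S₁` are
      -- the sums for `Q` at `h` and `suc h`, and `K₀`, `K₁`, `K₂` are the weights of `Q` at `h`,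
      -- `h + 1`, `h + 2`. `N` stands for |F| and `L` for |Q| + h; `a` and `a′` are the `stay`
      -- factors at `h` and `suc h`, and `b` is the `leave` factor.
      tail-free : ∀ a a′ b K₀ K₁ K₂ S₀ S₁ T N L →
        T + (a * K₀ + b * K₁) ≈ (a * S₀ + b * S₁) + x * K₁ →
        S₀ + (1# + L) * K₀ ≈ K₁ + N * K₀ →
        S₁ + (1# + (1# + L)) * K₁ ≈ K₂ + N * K₁ →
        a′ + b ≈ a + x →
        T + (1# + (1# + L)) * (a * K₀ + b * K₁) ≈ (a′ * K₁ + b * K₂) + N * (a * K₀ + b * K₁)
      tail-free a a′ b K₀ K₁ K₂ S₀ S₁ T N L eT e₀ e₁ ea = +-cancelʳ (b * K₁) _ _ (begin
        T + (1# + (1# + L)) * (a * K₀ + b * K₁) + b * K₁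
          ≈⟨ solve 6 (λ T L a b K₀ K₁ →
               T :+ (con 1 :+ (con 1 :+ L)) :* (a :* K₀ :+ b :* K₁) :+ b :* K₁
               := (T :+ (a :* K₀ :+ b :* K₁)) :+ ((con 1 :+ L) :* (a :* K₀ :+ b :* K₁) :+ b :* K₁))
               refl T L a b K₀ K₁ ⟩
        (T + (a * K₀ + b * K₁)) + ((1# + L) * (a * K₀ + b * K₁) + b * K₁)
          ≈⟨ +-congʳ eT ⟩
        ((a * S₀ + b * S₁) + x * K₁) + ((1# + L) * (a * K₀ + b * K₁) + b * K₁)
          ≈⟨ solve 8 (λ L a b x K₀ K₁ S₀ S₁ →
               ((a :* S₀ :+ b :* S₁) :+ x :* K₁) :+ ((con 1 :+ L) :* (a :* K₀ :+ b :* K₁) :+ b :* K₁)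
               := a :* (S₀ :+ (con 1 :+ L) :* K₀) :+ b :* (S₁ :+ (con 1 :+ (con 1 :+ L)) :* K₁) :+ x :* K₁)
               refl L a b x K₀ K₁ S₀ S₁ ⟩
        a * (S₀ + (1# + L) * K₀) + b * (S₁ + (1# + (1# + L)) * K₁) + x * K₁
          ≈⟨ +-congʳ (+-cong (*-congˡ e₀) (*-congˡ e₁)) ⟩
        a * (K₁ + N * K₀) + b * (K₂ + N * K₁) + x * K₁
          ≈⟨ solve 7 (λ N a b x K₀ K₁ K₂ →
               a :* (K₁ :+ N :* K₀) :+ b :* (K₂ :+ N :* K₁) :+ x :* K₁
               := (a :+ x) :* K₁ :+ (b :* K₂ :+ N :* (a :* K₀ :+ b :* K₁)))
               refl N a b x K₀ K₁ K₂ ⟩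
        (a + x) * K₁ + (b * K₂ + N * (a * K₀ + b * K₁))
          ≈⟨ +-congʳ (*-congʳ ea) ⟨
        (a′ + b) * K₁ + (b * K₂ + N * (a * K₀ + b * K₁))
          ≈⟨ solve 7 (λ N a b a′ K₀ K₁ K₂ →
               (a′ :+ b) :* K₁ :+ (b :* K₂ :+ N :* (a :* K₀ :+ b :* K₁))
               := (a′ :* K₁ :+ b :* K₂) :+ N :* (a :* K₀ :+ b :* K₁) :+ b :* K₁)
               refl N a b a′ K₀ K₁ K₂ ⟩
        (a′ * K₁ + b * K₂) + N * (a * K₀ + b * K₁) + b * K₁ ∎)

    -- The subtracted terms of Σ_{s ∈ F} weight Q h (F ∖ s)
    --   = weight Q (1 + h) F + (|F| - |Q| - h - 1) weight Q h F
    -- are moved to the left, so that the coefficients are natural numbers.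
    sum-weight : ∀ Q h {F} → Unique Q → Unique F →
      sumOver F (λ s → weight Q h (F ∖ s)) + ι (suc (length Q ℕ.+ h)) * weight Q h F
        ≈ weight Q (suc h) F + ι (length F) * weight Q h F
    sum-weight [] h {F} _ _ = begin
      sumOver F (λ _ → ι (h !)) + ι (suc h) * ι (h !)
        ≈⟨ +-cong (sumOver-const _ F) (sym (×1-homo-* (suc h) (h !))) ⟩
      ι (length F) * ι (h !) + ι (suc h !)
        ≈⟨ +-comm _ _ ⟩
      ι (suc h !) + ι (length F) * ι (h !) ∎
    sum-weight (i ∷ Q) h {F} (i∉ ∷ uQ) uF with _∈?_ _≟ᶠ_ i F
    -- Removing a seat other than `i` leaves the own seat free and the recursion unfolds as for `F`.
    -- Only the summand at `i` is of the taken kind, and `sumOver-exchange` trades it for the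
    -- uniform expression.
    ... | yes i∈F = tail-free _ _ _ _ _ _ _ _ _ _ _
            (trans (sumOver-exchange
                     {f = λ s → weight (i ∷ Q) h (F ∖ s)}
                     {g = λ s → stay (absent i) (suc (length Q)) h * weight Q h (F ∖ s)
                                + leave (absent i) * weight Q (suc h) (F ∖ s)}
                     uF i∈F
                     (λ {s} s∈ s≢i → reflexive (weight-free Q h (∈-∖⁺ i∈F (s≢i ∘ ≡.sym)))) ⟨≈ʳ
                    +-cong (*-congˡ (reflexive (weight-∖ Q h i∉Q))) (*-congˡ (reflexive (weight-∖ Q (suc h) i∉Q))))
                   (+-cong (sumOver-linear _ _ _ _ F)
                           (reflexive (≡.trans (weight-taken Q h (∉-∖ F i))
                                               (≡.cong (x *_) (weight-∖ Q (suc h) i∉Q))))))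
            (sum-weight Q h uQ uF)
            (trans (+-congˡ (*-congʳ (reflexive (≡.cong (ι ∘ suc) (≡.sym (ℕ.+-suc (length Q) h))))))
                   (sum-weight Q (suc h) uQ uF))
            (stay-suc (absent i) _ h)
      where
      i∉Q : i ∉ Q
      i∉Q i∈ = All.lookup i∉ i∈ ≡.refl
      _⟨≈ʳ_ : ∀ {a b b′ c} → a + b ≈ c → b ≈ b′ → a + b′ ≈ c
      p ⟨≈ʳ q = trans (+-congˡ (sym q)) p
    ... | no i∉F = begin
      sumOver F (λ s → weight (i ∷ Q) h (F ∖ s)) + ι (2 ℕ.+ length Q ℕ.+ h) * (x * weight Q (suc h) F)
        ≈⟨ +-cong (sumOver-cong F λ _ → reflexive (weight-taken Q h (i∉F ∘ ∈-∖⁻ F)))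
                  (*-congʳ (reflexive (≡.cong (ι ∘ suc) (≡.sym (ℕ.+-suc (length Q) h))))) ⟩
      sumOver F (λ s → x * weight Q (suc h) (F ∖ s)) + ι (suc (length Q ℕ.+ suc h)) * (x * weight Q (suc h) F)
        ≈⟨ +-congʳ (sumOver-*ˡ x _ F) ⟩
      x * sumOver F (λ s → weight Q (suc h) (F ∖ s)) + ι (suc (length Q ℕ.+ suc h)) * (x * weight Q (suc h) F)
        ≈⟨ solve 4 (λ x S L w → x :* S :+ L :* (x :* w) := x :* (S :+ L :* w)) refl x _ _ _ ⟩
      x * (sumOver F (λ s → weight Q (suc h) (F ∖ s)) + ι (suc (length Q ℕ.+ suc h)) * weight Q (suc h) F)
        ≈⟨ *-congˡ (sum-weight Q (suc h) uQ uF) ⟩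
      x * (weight Q (suc (suc h)) F + ι (length F) * weight Q (suc h) F)
        ≈⟨ solve 4 (λ x K₂ N K₁ → x :* (K₂ :+ N :* K₁) := x :* K₂ :+ N :* (x :* K₁)) refl x _ _ _ ⟩
      x * weight Q (suc (suc h)) F + ι (length F) * (x * weight Q (suc h) F) ∎

    -- With one seat more than passengers, the multiples of `weight Q 0 F` on the two sides of
    -- `sum-weight` coincide and cancel.
    sum-weight₀ : ∀ Q {F} → Unique Q → Unique F → length F ≡ suc (length Q) →
      sumOver F (λ s → weight Q 0 (F ∖ s)) ≈ weight Q 1 F
    sum-weight₀ Q {F} uQ uF eq = +-cancelʳ (ι (length F) * weight Q 0 F) _ _
      (trans (+-congˡ (*-congʳ (reflexive (≡.cong ι
               (≡.trans eq (≡.cong suc (≡.sym (ℕ.+-identityʳ (length Q)))))))))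
             (sum-weight Q 0 uQ uF))

    cost : Fin n → Fin n → Carrier → Carrier
    cost i s r = if does (s ≟ᶠ i) then r else x * r

    cost-own : ∀ i r → cost i i r ≡ r
    cost-own i r rewrite dec-true (i ≟ᶠ i) ≡.refl = ≡.refl

    cost-other : ∀ {i s} r → s ≢ i → cost i s r ≡ x * r
    cost-other {i} {s} r s≢i rewrite dec-false (s ≟ᶠ i) s≢i = ≡.refl

    sum-cost-taken : ∀ {i} Q {F} → Unique (i ∷ Q) → Unique F → length F ≡ suc (length Q) → i ∉ F →
      sumOver F (λ s → cost i s (weight Q 0 (F ∖ s))) ≈ weight (i ∷ Q) 0 F
    sum-cost-taken {i} Q {F} (_ ∷ uQ) uF eq i∉F = begin
      sumOver F (λ s → cost i s (weight Q 0 (F ∖ s)))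
        ≈⟨ sumOver-cong F (λ {s} s∈ → reflexive (cost-other {i} {s} _ λ { ≡.refl → i∉F s∈ })) ⟩
      sumOver F (λ s → x * weight Q 0 (F ∖ s)) ≈⟨ sumOver-*ˡ x _ F ⟩
      x * sumOver F (λ s → weight Q 0 (F ∖ s)) ≈⟨ *-congˡ (sum-weight₀ Q uQ uF eq) ⟩
      x * weight Q 1 F                         ≡⟨ weight-taken Q 0 i∉F ⟨
      weight (i ∷ Q) 0 F                       ∎

    -- Charging `x` for every seat is wrong only at the own seat, where the correction 1 - x is the
    -- factor `y`. Both sides get an extra `x * weight Q 0 F`, so that the correction can be written
    -- with `y + x`.
    sum-cost-absent : ∀ {i} Q {F} → Unique (i ∷ Q) → Unique F → length F ≡ suc (length Q) →
      absent i ≡ true →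
      sumOver F (λ s → cost i s (weight Q 0 (F ∖ s))) ≈ weight (i ∷ Q) 0 F
    sum-cost-absent {i} Q {F} uiQ@(i∉ ∷ uQ) uF eq abs with _∈?_ _≟ᶠ_ i F
    ... | no i∉F = trans (sum-cost-taken Q uiQ uF eq i∉F) (reflexive (weight-taken Q 0 i∉F))
    ... | yes i∈F rewrite abs = +-cancelʳ (x * weight Q 0 F) _ _ (begin
      sumOver F (λ s → cost i s (weight Q 0 (F ∖ s))) + x * weight Q 0 F
        ≡⟨ ≡.cong (λ r → sumOver F (λ s → cost i s (weight Q 0 (F ∖ s))) + x * r) (weight-∖ Q 0 i∉Q) ⟨
      sumOver F (λ s → cost i s (weight Q 0 (F ∖ s))) + x * weight Q 0 (F ∖ i)
        ≈⟨ sumOver-exchange uF i∈F (λ _ s≢i → reflexive (cost-other _ s≢i)) ⟩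
      sumOver F (λ s → x * weight Q 0 (F ∖ s)) + cost i i (weight Q 0 (F ∖ i))
        ≈⟨ +-cong (trans (sumOver-*ˡ x _ F) (*-congˡ (sum-weight₀ Q uQ uF eq)))
                  (reflexive (≡.trans (cost-own i _) (weight-∖ Q 0 i∉Q))) ⟩
      x * weight Q 1 F + weight Q 0 F
        ≈⟨ +-congˡ (trans (*-congʳ y+x≈1) (*-identityˡ _)) ⟨
      x * weight Q 1 F + (y + x) * weight Q 0 F
        ≈⟨ solve 4 (λ x y K₀ K₁ → x :* K₁ :+ (y :+ x) :* K₀ := (y :* K₀ :+ x :* K₁) :+ x :* K₀)
             refl x y _ _ ⟩
      (y * weight Q 0 F + x * weight Q 1 F) + x * weight Q 0 F ∎)
      where
      i∉Q : i ∉ Q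
      i∉Q i∈ = All.lookup i∉ i∈ ≡.refl

    -- A certain choice has no probability 1/|F| to absorb the new factor of |F|!. That factor is
    -- the `stay` factor of an attentive passenger at `h = 0`.
    own-weight : ∀ {i} Q {F} → i ∉ Q → i ∈ F → absent i ≡ false →
      ι (suc (length Q)) * cost i i (weight Q 0 (F ∖ i)) ≈ weight (i ∷ Q) 0 F
    own-weight {i} Q {F} i∉Q i∈F att = begin
      ι (suc (length Q)) * cost i i (weight Q 0 (F ∖ i))
        ≡⟨ ≡.cong (ι (suc (length Q)) *_) (≡.trans (cost-own i _) (weight-∖ Q 0 i∉Q)) ⟩
      ι (suc (length Q)) * weight Q 0 F
        ≈⟨ solve 4 (λ c x K₀ K₁ → c :* K₀ := (c :+ con 0 :* x) :* K₀ :+ con 0 :* K₁) refl _ x _ (weight Q 1 F) ⟩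
      stay false (suc (length Q)) 0 * weight Q 0 F + leave false * weight Q 1 F
        ≡⟨ ≡.trans (weight-free Q 0 i∈F) (≡.cong (λ b → stay b (suc (length Q)) 0 * weight Q 0 F + leave b * weight Q 1 F) att) ⟨
      weight (i ∷ Q) 0 F ∎

-- The Stirling recurrence from permutations counted by cycles.

module Stirling where

  open import Data.Bool.Properties using () renaming (_≟_ to _≟ᵇ_)
  open import Data.Fin.Base using (zero; suc; fromℕ<)
  open import Data.Fin.Properties using (any?; pigeonhole; toℕ-fromℕ<; toℕ<n) renaming (suc-injective to Fin-suc-injective)
  open import Data.Fin.Subset using (Subset)
  open import Data.List.Membership.Propositional.Properties
    using (∈-map⁺; ∈-map⁻; ∈-tabulate⁻; ∈-cartesianProductWith⁺; ∈-cartesianProductWith⁻; deduplicate-∈⇔)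
  open import Data.List.Membership.Propositional.Properties.WithK using (unique∧set⇒bag)
  open import Data.List.Relation.Binary.BagAndSetEquality using (∼bag⇒↭)
  open import Data.List.Relation.Binary.Permutation.Propositional using (_↭_)
  open import Data.List.Relation.Binary.Permutation.Propositional.Properties using (↭-length; filter-↭)
  import Data.List.Relation.Unary.All.Properties as All
  import Data.List.Relation.Unary.AllPairs as AllPairs
  import Data.List.Relation.Unary.AllPairs.Properties as AllPairs
  import Data.List.Relation.Unary.Unique.DecPropositional.Properties as DecUnique
  open import Data.Nat.Base using (_+_; _*_; _<_; _≤_)
  open import Data.Nat.DivMod using (_/_; _%_; m≡m%n+[m/n]*n; m%n<n)
  open import Data.Nat.GeneralisedArithmetic using (iterate)
  open import Data.Product.Base using (_×_)
  open import Data.Vec.Base as Vec using (Vec; []; _∷_; lookup)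
  open import Data.Vec.Properties as Vec using (≡-dec; lookup-map; lookup∘tabulate; tabulate-cong)
  import Data.Vec.Relation.Unary.All as Vec using (All; []; _∷_)
  import Data.Vec.Relation.Unary.All.Properties as VecAll
  import Data.Vec.Relation.Unary.AllPairs as VecPairs
  import Data.Vec.Relation.Unary.AllPairs.Properties as VecPairs
  open import Data.Vec.Relation.Unary.Unique.Propositional using () renaming (Unique to Distinct)
  open import Data.Vec.Relation.Unary.Unique.Propositional.Properties using (lookup-injective)
  open ≡ using (refl; sym; trans; cong; cong₂; subst; module ≡-Reasoning)

  module _ {a} {A : Set a} (f : A → A) where

    iterate-+ : ∀ x s t → iterate f x (s + t) ≡ iterate f (iterate f x s) t
    iterate-+ x zero    t = refl
    iterate-+ x (suc s) t = iterate-+ (f x) s t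

    Reach : A → A → Set a
    Reach x y = ∃ λ t → iterate f x t ≡ y

    Reach-refl : ∀ {x} → Reach x x
    Reach-refl = 0 , refl

    Reach-step : ∀ x → Reach x (f x)
    Reach-step x = 1 , refl

    Reach-trans : ∀ {x y z} → Reach x y → Reach y z → Reach x z
    Reach-trans {x} (s , refl) (t , refl) = s + t , iterate-+ x s t

  -- A simulation argument: one step of `f` may be matched by any number of steps of `g`. Insertion
  -- needs two steps in one case, deletion none.
  Reach-map : ∀ {a b} {A : Set a} {B : Set b} (f : A → A) (g : B → B) (h : A → B) →
              (∀ x → Reach g (h x) (h (f x))) → ∀ {x y} → Reach f x y → Reach g (h x) (h y)
  Reach-map f g h sim (zero  , refl) = Reach-refl g
  Reach-map f g h sim {x} (suc t , refl) = Reach-trans g (sim x) (Reach-map f g h sim (t , refl))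

  module _ {n} {f : Fin n → Fin n} (f-inj : ∀ {x y} → f x ≡ f y → x ≡ y) where

    iterate-injective : ∀ t {x y} → iterate f x t ≡ iterate f y t → x ≡ y
    iterate-injective zero    eq = eq
    iterate-injective (suc t) eq = f-inj (iterate-injective t eq)

    -- Two of the n + 1 iterates with exponents 0 to n agree, and injectivity strips the smaller
    -- exponent from both.
    period : ∀ x → ∃ λ d → suc d ≤ n × iterate f x (suc d) ≡ x
    period x with pigeonhole (ℕ.n<1+n n) (λ i → iterate f x (toℕ i))
    ... | i , j , i<j , eq with ℕ.m≤n⇒∃[o]m+o≡n i<j
    ...   | d , i+d≡j = d , ℕ.≤-trans (ℕ.m≤n+m (suc d) (toℕ i)) (subst (_≤ n) (sym i+1+d≡j) (ℕ.s≤s⁻¹ (toℕ<n j)))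
                      , sym (iterate-injective (toℕ i) (begin
      iterate f x (toℕ i)                         ≡⟨ eq ⟩
      iterate f x (toℕ j)                         ≡⟨ cong (iterate f x) (trans (ℕ.+-comm (suc d) (toℕ i)) i+1+d≡j) ⟨
      iterate f x (suc d + toℕ i)                 ≡⟨ iterate-+ f x (suc d) (toℕ i) ⟩
      iterate f (iterate f x (suc d)) (toℕ i)     ∎))
      where
      open ≡-Reasoning
      i+1+d≡j : toℕ i + suc d ≡ toℕ j
      i+1+d≡j = trans (ℕ.+-suc (toℕ i) d) i+d≡j

    module _ {x d} (per : iterate f x (suc d) ≡ x) where

      iterate-multiple : ∀ q → iterate f x (q * suc d) ≡ x
      iterate-multiple zero    = refl
      iterate-multiple (suc q) = trans (iterate-+ f x (suc d) (q * suc d))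
                                       (trans (cong (λ z → iterate f z (q * suc d)) per) (iterate-multiple q))

      iterate-% : ∀ t → iterate f x t ≡ iterate f x (t % suc d)
      iterate-% t = begin
        iterate f x t                                             ≡⟨ cong (iterate f x) (trans (m≡m%n+[m/n]*n t (suc d))
                                                                       (ℕ.+-comm (t % suc d) (t / suc d * suc d))) ⟩
        iterate f x (t / suc d * suc d + t % suc d)               ≡⟨ iterate-+ f x (t / suc d * suc d) (t % suc d) ⟩
        iterate f (iterate f x (t / suc d * suc d)) (t % suc d)   ≡⟨ cong (λ z → iterate f z (t % suc d)) (iterate-multiple (t / suc d)) ⟩
        iterate f x (t % suc d)                                   ∎
        where open ≡-Reasoning

    -- The exponent may be reduced modulo a period of at most n, so the search in `cycleThrough`
    -- misses nothing reachable.
    Reach-bounded : ∀ {x y} → Reach f x y → ∃ λ (t : Fin n) → iterate f x (toℕ t) ≡ y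
    Reach-bounded {x} (t , refl) with period x
    ... | d , d<n , per = fromℕ< t<n , trans (cong (iterate f x) (toℕ-fromℕ< t<n)) (sym (iterate-% per t))
      where
      t<n : t % suc d < n
      t<n = ℕ.<-≤-trans (m%n<n t (suc d)) d<n

    -- Completing the current period leads back to the start.
    Reach-sym : ∀ {x y} → Reach f x y → Reach f y x
    Reach-sym {x} (t , refl) with period x
    ... | d , _ , per = suc d ∸ t % suc d , (begin
      iterate f (iterate f x t) (suc d ∸ t % suc d)             ≡⟨ cong (λ z → iterate f z (suc d ∸ t % suc d)) (iterate-% per t) ⟩
      iterate f (iterate f x (t % suc d)) (suc d ∸ t % suc d)   ≡⟨ iterate-+ f x (t % suc d) (suc d ∸ t % suc d) ⟨
      iterate f x (t % suc d + (suc d ∸ t % suc d))             ≡⟨ cong (iterate f x) (ℕ.m+[n∸m]≡n (ℕ.<⇒≤ (m%n<n t (suc d)))) ⟩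
      iterate f x (suc d)                                       ≡⟨ per ⟩
      x                                                         ∎)
      where open ≡-Reasoning


  lookup-inj : ∀ {n} {A : Set} {σ : Vec A n} → Distinct σ → ∀ {x y} → lookup σ x ≡ lookup σ y → x ≡ y
  lookup-inj u = lookup-injective u _ _

  module _ {n} {σ : Vec (Fin n) n} (σ! : Distinct σ) where

    -- `y` belongs to its own cycle, hence to that of `x`; a failed search would make the membership
    -- bits at `y` differ.
    cycle⇒Reach : ∀ {x y} → cycleThrough σ x ≡ cycleThrough σ y → Reach (lookup σ) x y
    cycle⇒Reach {x} {y} eq with any? {n} (λ t → iterate (lookup σ) x (toℕ t) ≟ᶠ y) in found
    ... | yes (t , hit) = toℕ t , hit
    ... | no  _         = contradiction (begin
      false                                              ≡⟨ cong does found ⟨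
      does (any? {n} λ t → iterate (lookup σ) x (toℕ t) ≟ᶠ y)           ≡⟨ lookup∘tabulate _ y ⟨
      lookup (cycleThrough σ x) y                                       ≡⟨ cong (λ c → lookup c y) eq ⟩
      lookup (cycleThrough σ y) y                                       ≡⟨ lookup∘tabulate _ y ⟩
      does (any? {n} λ t → iterate (lookup σ) y (toℕ t) ≟ᶠ y)           ≡⟨ dec-true (any? {n} λ t → iterate (lookup σ) y (toℕ t) ≟ᶠ y)
                                                                             (Reach-bounded (lookup-inj σ!) (Reach-refl (lookup σ))) ⟩
      true                                               ∎) λ ()
      where
      open ≡-Reasoning

    Reach⇒cycle : ∀ {x y} → Reach (lookup σ) x y → cycleThrough σ x ≡ cycleThrough σ y
    Reach⇒cycle {x} {y} r = tabulate-cong λ z → does-⇔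
      (mk⇔ (λ (t , hit) → Reach-bounded (lookup-inj σ!) (Reach-trans (lookup σ) (Reach-sym (lookup-inj σ!) r) (toℕ t , hit)))
           (λ (t , hit) → Reach-bounded (lookup-inj σ!) (Reach-trans (lookup σ) r (toℕ t , hit))))
      (any? λ t → iterate (lookup σ) x (toℕ t) ≟ᶠ z) (any? λ t → iterate (lookup σ) y (toℕ t) ≟ᶠ z)

  unique-set-length : ∀ {a} {A : Set a} {xs ys : List A} → Unique xs → Unique ys →
                      (∀ {z} → z ∈ xs ⇔ z ∈ ys) → length xs ≡ length ys
  unique-set-length u v eq = ↭-length (∼bag⇒↭ (unique∧set⇒bag u v eq))

  _≟ˢ_ : ∀ {n} (s t : Subset n) → Dec (s ≡ t)
  _≟ˢ_ = ≡-dec _≟ᵇ_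

  -- R contains exactly one element of every cycle.
  IsTransversal : ∀ {n} → Vec (Fin n) n → List (Fin n) → Set
  IsTransversal σ R = Unique (map (cycleThrough σ) R) × (∀ x → cycleThrough σ x ∈ map (cycleThrough σ) R)

  -- The deduplicated cycles and the cycles of the representatives are duplicate-free lists with the
  -- same entries. Representatives are easy to follow through an insertion, unlike the output of
  -- `deduplicate`.
  numCycles-transversal : ∀ {n} (σ : Vec (Fin n) n) R → IsTransversal σ R → numCycles σ ≡ length R
  numCycles-transversal {n} σ R (R! , covers) = trans
    (unique-set-length (DecUnique.deduplicate-! _≟ˢ_ (map (cycleThrough σ) (allFin n))) R! (mk⇔ to from))
    (length-map (cycleThrough σ) R)
    where
    to : ∀ {c} → c ∈ deduplicate _≟ˢ_ (map (cycleThrough σ) (allFin n)) → c ∈ map (cycleThrough σ) R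
    to c∈ with ∈-map⁻ (cycleThrough σ) (Equivalence.from (deduplicate-∈⇔ _≟ˢ_) c∈)
    ... | x , _ , refl = covers x
    from : ∀ {c} → c ∈ map (cycleThrough σ) R → c ∈ deduplicate _≟ˢ_ (map (cycleThrough σ) (allFin n))
    from c∈ with ∈-map⁻ (cycleThrough σ) c∈
    ... | x , _ , refl = Equivalence.to (deduplicate-∈⇔ _≟ˢ_) (∈-map⁺ (cycleThrough σ) (∈-allFin x))

  map-surjective : ∀ {a b} {A : Set a} {B : Set b} (f : A → B) {ys : List B} →
                   (∀ {y} → y ∈ ys → ∃ λ x → f x ≡ y) → ∃ λ xs → map f xs ≡ ys
  map-surjective f {[]}     pre = [] , refl
  map-surjective f {y ∷ ys} pre with pre (here refl) | map-surjective f (pre ∘ there)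
  ... | x , refl | xs , refl = x ∷ xs , refl

  transversal : ∀ {n} (σ : Vec (Fin n) n) → ∃ (IsTransversal σ)
  transversal {n} σ with map-surjective (cycleThrough σ) {deduplicate _≟ˢ_ (map (cycleThrough σ) (allFin n))} pre
    where
    pre : ∀ {c} → c ∈ deduplicate _≟ˢ_ (map (cycleThrough σ) (allFin n)) → ∃ λ x → cycleThrough σ x ≡ c
    pre c∈ with ∈-map⁻ (cycleThrough σ) (Equivalence.from (deduplicate-∈⇔ _≟ˢ_) c∈)
    ... | x , _ , refl = x , refl
  ... | R , eq = R , subst Unique (sym eq) (DecUnique.deduplicate-! _≟ˢ_ (map (cycleThrough σ) (allFin n)))
                   , λ x → subst (cycleThrough σ x ∈_) (sym eq)
                             (Equivalence.to (deduplicate-∈⇔ _≟ˢ_) (∈-map⁺ (cycleThrough σ) (∈-allFin x)))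


  -- insert p σ puts a new element 0 into the cycles of σ (whose elements are moved
  -- up by one) just before p, and as a fixed point if p = 0.
  relabel : ∀ {n} → Fin (suc n) → Fin n → Fin (suc n)
  relabel zero    v = suc v
  relabel (suc r) v with v ≟ᶠ r
  ... | yes _ = zero
  ... | no  _ = suc v

  relabel-injective : ∀ {n} (p : Fin (suc n)) {v w} → relabel p v ≡ relabel p w → v ≡ w
  relabel-injective zero    eq = Fin-suc-injective eq
  relabel-injective (suc r) {v} {w} eq with v ≟ᶠ r | w ≟ᶠ r
  ... | yes refl | yes refl = refl
  ... | no  _    | no  _    = Fin-suc-injective eq

  relabel-avoids : ∀ {n} (p : Fin (suc n)) v → p ≢ relabel p v
  relabel-avoids (suc r) v eq with v ≟ᶠ r
  ... | no v≢r = v≢r (sym (Fin-suc-injective eq))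

  -- With injectivity and avoidance of `p`, this makes `relabel p` a bijection onto the values other
  -- than `p`. Hence every permutation of n + 1 elements is an `insert` in exactly one way.
  relabel-surjective : ∀ {n} (p : Fin (suc n)) {w} → p ≢ w → ∃ λ v → relabel p v ≡ w
  relabel-surjective zero    {zero}  p≢w = contradiction refl p≢w
  relabel-surjective zero    {suc v} p≢w = v , refl
  relabel-surjective (suc r) {zero}  p≢w = r , lemma
    where
    lemma : relabel (suc r) r ≡ zero
    lemma with r ≟ᶠ r
    ... | yes _   = refl
    ... | no  r≢r = contradiction refl r≢r
  relabel-surjective (suc r) {suc v} p≢w = v , lemma
    where
    lemma : relabel (suc r) v ≡ suc v
    lemma with v ≟ᶠ r
    ... | yes refl = contradiction refl p≢w
    ... | no  _    = refl

  insert : ∀ {n} → Fin (suc n) → Vec (Fin n) n → Vec (Fin (suc n)) (suc n)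
  insert p σ = p ∷ Vec.map (relabel p) σ

  module _ {n} {σ : Vec (Fin n) n} (σ! : Distinct σ) where

    insert-distinct : ∀ p → Distinct (insert p σ)
    insert-distinct p = VecAll.map⁺ (universal σ) VecPairs.∷ VecPairs.map⁺ (VecPairs.map (_∘ relabel-injective p) σ!)
      where
      universal : ∀ {m} (τ : Vec (Fin n) m) → Vec.All (λ v → p ≢ relabel p v) τ
      universal []      = Vec.[]
      universal (v ∷ τ) = relabel-avoids p v Vec.∷ universal τ

    private
      σ′ : Fin (suc n) → Fin (suc n) → Fin (suc n)
      σ′ p = lookup (insert p σ)

    insert-simulates : ∀ p x → Reach (σ′ p) (suc x) (suc (lookup σ x))
    insert-simulates zero    x = 1 , lookup-map x suc σ
    insert-simulates (suc r) x with lookup σ x ≟ᶠ r in eq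
    -- The former step into `r` now passes through `zero`, which is sent on to `suc r`.
    ... | yes refl = 2 , cong (σ′ (suc r)) (trans (lookup-map x (relabel (suc r)) σ) lemma)
      where
      lemma : relabel (suc r) (lookup σ x) ≡ zero
      lemma rewrite eq = refl
    ... | no  _    = 1 , trans (lookup-map x (relabel (suc r)) σ) lemma
      where
      lemma : relabel (suc r) (lookup σ x) ≡ suc (lookup σ x)
      lemma rewrite eq = refl

    Reach-insert : ∀ p {x y} → Reach (lookup σ) x y → Reach (σ′ p) (suc x) (suc y)
    Reach-insert p = Reach-map (lookup σ) (σ′ p) suc (insert-simulates p)

    iterate-insert-zero : ∀ x t → iterate (σ′ zero) (suc x) t ≡ suc (iterate (lookup σ) x t)
    iterate-insert-zero x zero    = refl
    iterate-insert-zero x (suc t) = trans (cong (λ z → iterate (σ′ zero) z t) (lookup-map x suc σ))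
                                          (iterate-insert-zero (lookup σ x) t)

    -- Deletes 0 from its cycle by identifying it with its successor.
    collapse : Fin n → Fin (suc n) → Fin n
    collapse r zero    = r
    collapse r (suc x) = x

    collapse-simulates : ∀ r z → Reach (lookup σ) (collapse r z) (collapse r (σ′ (suc r) z))
    -- `zero` and its successor `suc r` are identified, so nothing moves.
    collapse-simulates r zero    = 0 , refl
    collapse-simulates r (suc x) = 1 , sym (trans (cong (collapse r) (lookup-map x (relabel (suc r)) σ)) lemma)
      where
      lemma : collapse r (relabel (suc r) (lookup σ x)) ≡ lookup σ x
      lemma with lookup σ x ≟ᶠ r
      ... | yes eq = sym eq
      ... | no  _  = refl

    Reach-uninsert : ∀ p {x y} → Reach (σ′ p) (suc x) (suc y) → Reach (lookup σ) x y
    Reach-uninsert zero    {x} (t , eq) = t , Fin-suc-injective (trans (sym (iterate-insert-zero x t)) eq)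
    Reach-uninsert (suc r) reach = Reach-map (σ′ (suc r)) (lookup σ) (collapse r) (collapse-simulates r) reach

    cyc′ : Fin (suc n) → Fin (suc n) → Subset (suc n)
    cyc′ p = cycleThrough (insert p σ)

    transversal-suc : ∀ p {R} → IsTransversal σ R →
      Unique (map (cyc′ p) (map suc R)) × (∀ x → cyc′ p (suc x) ∈ map (cyc′ p) (map suc R))
    transversal-suc p {R} (R! , covers)
      = AllPairs.map⁺ (AllPairs.map⁺ (AllPairs.map
          (λ ≢ eq → ≢ (Reach⇒cycle σ! (Reach-uninsert p (cycle⇒Reach (insert-distinct p) eq))))
          (AllPairs.map⁻ R!)))
      , cover
      where
      cover : ∀ x → cyc′ p (suc x) ∈ map (cyc′ p) (map suc R)
      cover x with ∈-map⁻ (cycleThrough σ) (covers x)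
      ... | y , y∈R , eq = subst (_∈ map (cyc′ p) (map suc R))
        (sym (Reach⇒cycle (insert-distinct p) (Reach-insert p (cycle⇒Reach σ! eq))))
        (∈-map⁺ (cyc′ p) (∈-map⁺ suc y∈R))

    -- `zero` joins the cycle of `suc r`, so the lifted representatives still meet every cycle.
    numCycles-insert-suc : ∀ r → numCycles (insert (suc r) σ) ≡ numCycles σ
    numCycles-insert-suc r with transversal σ
    ... | R , isT = trans
      (numCycles-transversal (insert (suc r) σ) (map suc R) (proj₁ (transversal-suc (suc r) isT) , cover))
      (trans (length-map suc R) (sym (numCycles-transversal σ R isT)))
      where
      cover : ∀ z → cyc′ (suc r) z ∈ map (cyc′ (suc r)) (map suc R)
      cover (suc x) = proj₂ (transversal-suc (suc r) isT) x
      cover zero    = subst (_∈ map (cyc′ (suc r)) (map suc R))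
        (sym (Reach⇒cycle (insert-distinct (suc r)) (Reach-step (σ′ (suc r)) zero)))
        (cover (suc r))

    -- `zero` is a fixed point that no lifted element reaches, so it is a further representative.
    numCycles-insert-zero : numCycles (insert zero σ) ≡ suc (numCycles σ)
    numCycles-insert-zero with transversal σ
    ... | R , isT = trans
      (numCycles-transversal (insert zero σ) (zero ∷ map suc R) (fresh ∷ proj₁ (transversal-suc zero isT) , cover))
      (cong suc (trans (length-map suc R) (sym (numCycles-transversal σ R isT))))
      where
      fresh : All (cyc′ zero zero ≢_) (map (cyc′ zero) (map suc R))
      fresh = All.map⁺ (All.map⁺ (All.universal (λ x eq → apart x (cycle⇒Reach (insert-distinct zero) (sym eq))) R))
        where
        apart : ∀ x → ¬ Reach (σ′ zero) (suc x) zero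
        apart x (t , eq) with trans (sym eq) (iterate-insert-zero x t)
        ... | ()
      cover : ∀ z → cyc′ zero z ∈ map (cyc′ zero) (zero ∷ map suc R)
      cover zero    = here refl
      cover (suc x) = there (proj₂ (transversal-suc zero isT) x)


  -- Enumerating permutations by insertion.

  ∈-words : ∀ {a} {A : Set a} {xs : List A} → (∀ x → x ∈ xs) → ∀ {k} (v : Vec A k) → v ∈ words xs k
  ∈-words all []      = here refl
  ∈-words all (x ∷ v) = ∈-cartesianProductWith⁺ _∷_ (all x) (∈-words all v)

  words-unique : ∀ {a} {A : Set a} {xs : List A} → Unique xs → ∀ k → Unique (words xs k)
  words-unique u zero    = [] ∷ []
  words-unique u (suc k) = Unique.cartesianProductWith⁺ _∷_ Vec.∷-injective u (words-unique u k)

  distinct? : ∀ {n k} → Decidable (Distinct {A = Fin n} {k})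
  distinct? = VecPairs.allPairs? (λ x y → ¬? (x ≟ᶠ y))

  ∈-permutations⁺ : ∀ {n} {σ : Vec (Fin n) n} → Distinct σ → σ ∈ permutations n
  ∈-permutations⁺ {n} {σ} = ∈-filter⁺ distinct? (∈-words ∈-allFin σ)

  ∈-permutations⁻ : ∀ {n} {σ : Vec (Fin n) n} → σ ∈ permutations n → Distinct σ
  ∈-permutations⁻ {n} = proj₂ ∘ ∈-filter⁻ distinct? {xs = words (allFin n) n}

  permutations-unique : ∀ n → Unique (permutations n)
  permutations-unique n = Unique.filter⁺ distinct? (words-unique (Unique.allFin⁺ n) n)

  uninsert : ∀ {n k} (p : Fin (suc n)) {τ : Vec (Fin (suc n)) k} → Vec.All (p ≢_) τ → ∃ λ σ → Vec.map (relabel p) σ ≡ τ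
  uninsert p Vec.[]        = [] , refl
  uninsert p (p≢w Vec.∷ a) with relabel-surjective p p≢w | uninsert p a
  ... | v , refl | σ , refl = v ∷ σ , refl

  distinct-map⁻ : ∀ {a b} {A : Set a} {B : Set b} (f : A → B) {k} (v : Vec A k) → Distinct (Vec.map f v) → Distinct v
  distinct-map⁻ f []      _               = VecPairs.[]
  distinct-map⁻ f (x ∷ v) (x∉ VecPairs.∷ v!) = avoid v x∉ VecPairs.∷ distinct-map⁻ f v v!
    where
    avoid : ∀ {k} (v : Vec _ k) → Vec.All (f x ≢_) (Vec.map f v) → Vec.All (x ≢_) v
    avoid []      Vec.[]        = Vec.[]
    avoid (y ∷ v) (≢ Vec.∷ a) = (≢ ∘ cong f) Vec.∷ avoid v a

  map-injective : ∀ {a b} {A : Set a} {B : Set b} {f : A → B} → (∀ {x y} → f x ≡ f y → x ≡ y) →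
                  ∀ {k} {v w : Vec A k} → Vec.map f v ≡ Vec.map f w → v ≡ w
  map-injective f-inj {v = []}    {[]}    _  = refl
  map-injective f-inj {v = x ∷ v} {y ∷ w} eq =
    cong₂ _∷_ (f-inj (Vec.∷-injectiveˡ eq)) (map-injective f-inj (Vec.∷-injectiveʳ eq))

  insert-injective : ∀ {n} {p q : Fin (suc n)} {σ τ : Vec (Fin n) n} → insert p σ ≡ insert q τ → p ≡ q × σ ≡ τ
  insert-injective {p = p} eq with Vec.∷-injectiveˡ eq
  ... | refl = refl , map-injective (relabel-injective p) (Vec.∷-injectiveʳ eq)

  -- Counting ignores order, so it is enough that both lists are duplicate-free and have the same
  -- entries.
  permutations-insert : ∀ n → permutations (suc n) ↭ cartesianProductWith insert (allFin (suc n)) (permutations n)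
  permutations-insert n = ∼bag⇒↭ (unique∧set⇒bag (permutations-unique (suc n))
    (Unique.cartesianProductWith⁺ insert insert-injective (Unique.allFin⁺ (suc n)) (permutations-unique n))
    (mk⇔ to from))
    where
    to : ∀ {τ} → τ ∈ permutations (suc n) → τ ∈ cartesianProductWith insert (allFin (suc n)) (permutations n)
    to {p ∷ τ} τ∈ with ∈-permutations⁻ τ∈
    ... | p∉ VecPairs.∷ τ! with uninsert p p∉
    ...   | σ , refl = ∈-cartesianProductWith⁺ insert (∈-allFin p) (∈-permutations⁺ (distinct-map⁻ (relabel p) σ τ!))
    from : ∀ {τ} → τ ∈ cartesianProductWith insert (allFin (suc n)) (permutations n) → τ ∈ permutations (suc n)
    from τ∈ with ∈-cartesianProductWith⁻ insert (allFin (suc n)) (permutations n) τ∈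
    ... | p , σ , _ , σ∈ , refl = ∈-permutations⁺ (insert-distinct (∈-permutations⁻ σ∈) p)


  count : ∀ {a p} {A : Set a} {P : Pred A p} → Decidable P → List A → ℕ
  count P? xs = length (filter P? xs)

  count-map : ∀ {a b p q} {A : Set a} {B : Set b} {P : Pred A p} {Q : Pred B q} (P? : Decidable P) (Q? : Decidable Q)
    (f : A → B) xs → (∀ {x} → x ∈ xs → Q (f x) ⇔ P x) → count Q? (map f xs) ≡ count P? xs
  count-map P? Q? f []       eq = refl
  count-map P? Q? f (x ∷ xs) eq with does (P? x) | does (Q? (f x)) | does-⇔ (eq (here refl)) (Q? (f x)) (P? x)
  ... | true  | _ | refl = cong suc (count-map P? Q? f xs (eq ∘ there))
  ... | false | _ | refl = count-map P? Q? f xs (eq ∘ there)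

  count-++ : ∀ {a p} {A : Set a} {P : Pred A p} (P? : Decidable P) xs ys → count P? (xs ++ ys) ≡ count P? xs + count P? ys
  count-++ P? xs ys = trans (cong length (filter-++ P? xs ys)) (length-++ (filter P? xs))

  count-product : ∀ {a b c p q} {A : Set a} {B : Set b} {C : Set c} {P : Pred B p} {Q : Pred C q}
    (P? : Decidable P) (Q? : Decidable Q) (f : A → B → C) xs ys →
    (∀ {x y} → x ∈ xs → y ∈ ys → Q (f x y) ⇔ P y) →
    count Q? (cartesianProductWith f xs ys) ≡ length xs * count P? ys
  count-product P? Q? f []       ys eq = refl
  count-product P? Q? f (x ∷ xs) ys eq = trans (count-++ Q? (map (f x) ys) _)
    (cong₂ _+_ (count-map P? Q? (f x) ys (eq (here refl))) (count-product P? Q? f xs ys (eq ∘ there)))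

  -- Inserting a fixed point raises the number of cycles by one; the other n positions preserve it.
  -- The predicate `Q` stays abstract because the condition on `σ` in the first case is an equation
  -- when `j` is positive and impossible when `j` is 0.
  stirling₁-insert : ∀ n j {p} {Q : Pred (Vec (Fin n) n) p} (Q? : Decidable Q) →
    (∀ {σ} → ℤ.+ suc (numCycles σ) ≡ j ⇔ Q σ) →
    stirling₁ (suc n) j ≡ count Q? (permutations n) + n * stirling₁ n j
  stirling₁-insert n j {Q = Q} Q? eq = begin
    count J? (permutations (suc n))
      ≡⟨ ↭-length (filter-↭ J? (permutations-insert n)) ⟩
    count J? (map (insert zero) (permutations n) ++ cartesianProductWith insert (tabulate suc) (permutations n))
      ≡⟨ count-++ J? (map (insert zero) (permutations n)) _ ⟩
    count J? (map (insert zero) (permutations n)) + count J? (cartesianProductWith insert (tabulate suc) (permutations n))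
      ≡⟨ cong₂ _+_
           (count-map Q? J? (insert zero) (permutations n) λ {σ} σ∈ →
             subst (λ c → ℤ.+ c ≡ j ⇔ Q σ) (sym (numCycles-insert-zero (∈-permutations⁻ σ∈))) (eq {σ}))
           (trans (count-product (λ σ → ℤ.+ numCycles σ ℤ.≟ j) J? insert (tabulate suc) (permutations n) same)
                  (cong (_* stirling₁ n j) (length-tabulate {n = n} Fin.suc))) ⟩
    count Q? (permutations n) + n * stirling₁ n j ∎
    where
    open ≡-Reasoning
    J? : Decidable (λ (σ : Vec (Fin (suc n)) (suc n)) → ℤ.+ numCycles σ ≡ j)
    J? σ = ℤ.+ numCycles σ ℤ.≟ j
    same : ∀ {p σ} → p ∈ tabulate suc → σ ∈ permutations n → ℤ.+ numCycles (insert p σ) ≡ j ⇔ ℤ.+ numCycles σ ≡ j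
    same p∈ σ∈ with ∈-tabulate⁻ p∈
    ... | r , refl = mk⇔ (trans (cong ℤ.+_ (sym e))) (trans (cong ℤ.+_ e))
      where e = numCycles-insert-suc (∈-permutations⁻ σ∈) r

  stirling₁-suc : ∀ n u → stirling₁ (suc n) (ℤ.+ suc u) ≡ stirling₁ n (ℤ.+ u) + n * stirling₁ n (ℤ.+ suc u)
  stirling₁-suc n u = stirling₁-insert n (ℤ.+ suc u) (λ σ → ℤ.+ numCycles σ ℤ.≟ ℤ.+ u)
    (mk⇔ (λ { refl → refl }) (λ { refl → refl }))

  stirling₁-zero : ∀ n → stirling₁ (suc n) (ℤ.+ 0) ≡ 0
  stirling₁-zero n = trans (stirling₁-insert n (ℤ.+ 0) (λ _ → no id) (mk⇔ (λ ()) (λ ())))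
    (cong₂ _+_ (cong length (filter-none (λ _ → no id) (All.universal (λ _ ()) (permutations n)))) (rest n))
    where
    rest : ∀ n → n * stirling₁ n (ℤ.+ 0) ≡ 0
    -- The empty permutation has no cycles, so `stirling₁ 0 (+ 0)` is 1; the product vanishes
    -- through its factor 0.
    rest zero    = refl
    rest (suc n) = trans (cong (suc n *_) (stirling₁-zero n)) (ℕ.*-zeroʳ (suc n))

open import Data.Nat.Combinatorics
  using (_C_; k>n⇒nCk≡0; nCk≡n!/k![n-k]!; k![n∸k]!∣n!; nCk+nC[k+1]≡[n+1]C[k+1])
open import Data.Product.Base using (_×_)
open ≡ using (refl; sym; trans; cong; cong₂; subst; module ≡-Reasoning)
open Stirling using (stirling₁-zero; stirling₁-suc)
open import Data.Rational.Base using (ℚ; 0ℚ; 1ℚ; _+_; _*_; _-_; -_; _/_; toℚᵘ)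
open import Data.Rational.Properties
open import Data.Rational.Solver using (module +-*-Solver)
import Data.Rational.Unnormalised.Base as ℚᵘ
import Data.Rational.Unnormalised.Properties as ℚᵘ

-- The ring of formal power series over the rationals.

Series : Set
Series = ℕ → ℚ

infix 4 _≐_
infixl 7 _⊛_
infixl 6 _⊕_

_≐_ : Series → Series → Set
f ≐ g = ∀ m → f m ≡ g m

_⊕_ : Series → Series → Series
(f ⊕ g) m = f m + g m

-- The Cauchy product, by splitting `f` into its constant term and X times `f ∘ suc`. This keeps
-- finite sums out of the ring axioms.
_⊛_ : Series → Series → Series
(f ⊛ g) zero    = f 0 * g 0
(f ⊛ g) (suc m) = f 0 * g (suc m) + (f ∘ suc ⊛ g) m

const : ℚ → Series
const q zero    = q
const q (suc _) = 0ℚ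

shift : Series → Series
shift f zero    = 0ℚ
shift f (suc m) = f m

⊛-cong : ∀ {f f′ g g′} → f ≐ f′ → g ≐ g′ → f ⊛ g ≐ f′ ⊛ g′
⊛-cong p q zero    = cong₂ _*_ (p 0) (q 0)
⊛-cong p q (suc m) = cong₂ _+_ (cong₂ _*_ (p 0) (q (suc m))) (⊛-cong (p ∘ suc) q m)

-- The mirror image of the defining clause, splitting `g` in place of `f`; commutativity rests on
-- it.
⊛-suc : ∀ f g m → (f ⊛ g) (suc m) ≡ f (suc m) * g 0 + (f ⊛ g ∘ suc) m
⊛-suc f g zero    = +-comm (f 0 * g 1) (f 1 * g 0)
⊛-suc f g (suc m) = begin
  f 0 * g (suc (suc m)) + (f ∘ suc ⊛ g) (suc m)
    ≡⟨ cong (f 0 * g (suc (suc m)) +_) (⊛-suc (f ∘ suc) g m) ⟩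
  f 0 * g (suc (suc m)) + (f (suc (suc m)) * g 0 + (f ∘ suc ⊛ g ∘ suc) m)
    ≡⟨ solve 3 (λ a b c → a :+ (b :+ c) := b :+ (a :+ c)) refl
         (f 0 * g (suc (suc m))) (f (suc (suc m)) * g 0) _ ⟩
  f (suc (suc m)) * g 0 + (f ⊛ g ∘ suc) (suc m) ∎
  where
  open +-*-Solver
  open ≡-Reasoning

⊛-comm : ∀ f g → f ⊛ g ≐ g ⊛ f
⊛-comm f g zero    = *-comm (f 0) (g 0)
⊛-comm f g (suc m) = begin
  f 0 * g (suc m) + (f ∘ suc ⊛ g) m ≡⟨ cong₂ _+_ (*-comm (f 0) (g (suc m))) (⊛-comm (f ∘ suc) g m) ⟩
  g (suc m) * f 0 + (g ⊛ f ∘ suc) m ≡⟨ ⊛-suc g f m ⟨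
  (g ⊛ f) (suc m)                   ∎
  where open ≡-Reasoning

⊛-distribʳ : ∀ h f g → (f ⊕ g) ⊛ h ≐ (f ⊛ h) ⊕ (g ⊛ h)
⊛-distribʳ h f g zero    = *-distribʳ-+ (h 0) (f 0) (g 0)
⊛-distribʳ h f g (suc m) = begin
  (f 0 + g 0) * h (suc m) + ((f ⊕ g) ∘ suc ⊛ h) m
    ≡⟨ cong ((f 0 + g 0) * h (suc m) +_) (⊛-distribʳ h (f ∘ suc) (g ∘ suc) m) ⟩
  (f 0 + g 0) * h (suc m) + ((f ∘ suc ⊛ h) m + (g ∘ suc ⊛ h) m)
    ≡⟨ solve 5 (λ a b c d e → (a :+ b) :* c :+ (d :+ e) := (a :* c :+ d) :+ (b :* c :+ e)) refl
         (f 0) (g 0) (h (suc m)) _ _ ⟩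
  (f ⊛ h) (suc m) + (g ⊛ h) (suc m) ∎
  where
  open +-*-Solver
  open ≡-Reasoning

⊛-distribˡ : ∀ h f g → h ⊛ (f ⊕ g) ≐ (h ⊛ f) ⊕ (h ⊛ g)
⊛-distribˡ h f g m = begin
  (h ⊛ (f ⊕ g)) m         ≡⟨ ⊛-comm h (f ⊕ g) m ⟩
  ((f ⊕ g) ⊛ h) m         ≡⟨ ⊛-distribʳ h f g m ⟩
  (f ⊛ h) m + (g ⊛ h) m   ≡⟨ cong₂ _+_ (⊛-comm f h m) (⊛-comm g h m) ⟩
  (h ⊛ f) m + (h ⊛ g) m   ∎
  where open ≡-Reasoning

⊛-scale : ∀ q f g → ((q *_) ∘ f) ⊛ g ≐ (q *_) ∘ (f ⊛ g)
⊛-scale q f g zero    = *-assoc q (f 0) (g 0)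
⊛-scale q f g (suc m) = begin
  q * f 0 * g (suc m) + (((q *_) ∘ f ∘ suc) ⊛ g) m
    ≡⟨ cong (q * f 0 * g (suc m) +_) (⊛-scale q (f ∘ suc) g m) ⟩
  q * f 0 * g (suc m) + q * (f ∘ suc ⊛ g) m
    ≡⟨ solve 4 (λ q a b c → q :* a :* b :+ q :* c := q :* (a :* b :+ c)) refl
         q (f 0) (g (suc m)) _ ⟩
  q * (f ⊛ g) (suc m) ∎
  where
  open +-*-Solver
  open ≡-Reasoning

⊛-assoc : ∀ f g h → (f ⊛ g) ⊛ h ≐ f ⊛ (g ⊛ h)
⊛-assoc f g h zero    = *-assoc (f 0) (g 0) (h 0)
⊛-assoc f g h (suc m) = begin
  f 0 * g 0 * h (suc m) + ((((f 0 *_) ∘ g ∘ suc) ⊕ (f ∘ suc ⊛ g)) ⊛ h) m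
    ≡⟨ cong (f 0 * g 0 * h (suc m) +_) (⊛-distribʳ h ((f 0 *_) ∘ g ∘ suc) (f ∘ suc ⊛ g) m) ⟩
  f 0 * g 0 * h (suc m) + ((((f 0 *_) ∘ g ∘ suc) ⊛ h) m + ((f ∘ suc ⊛ g) ⊛ h) m)
    ≡⟨ cong (f 0 * g 0 * h (suc m) +_)
         (cong₂ _+_ (⊛-scale (f 0) (g ∘ suc) h m) (⊛-assoc (f ∘ suc) g h m)) ⟩
  f 0 * g 0 * h (suc m) + (f 0 * (g ∘ suc ⊛ h) m + (f ∘ suc ⊛ (g ⊛ h)) m)
    ≡⟨ solve 5 (λ a b c d e → a :* b :* c :+ (a :* d :+ e) := a :* (b :* c :+ d) :+ e) refl
         (f 0) (g 0) (h (suc m)) _ _ ⟩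
  f 0 * (g ⊛ h) (suc m) + (f ∘ suc ⊛ (g ⊛ h)) m ∎
  where
  open +-*-Solver
  open ≡-Reasoning

⊛-zeroˡ : ∀ f → (λ _ → 0ℚ) ⊛ f ≐ (λ _ → 0ℚ)
⊛-zeroˡ f zero    = *-zeroˡ (f 0)
⊛-zeroˡ f (suc m) = cong₂ _+_ (*-zeroˡ (f (suc m))) (⊛-zeroˡ f m)

const-⊛ : ∀ q f → const q ⊛ f ≐ (q *_) ∘ f
const-⊛ q f zero    = refl
const-⊛ q f (suc m) = trans (cong (q * f (suc m) +_) (⊛-zeroˡ f m)) (+-identityʳ _)

X : Series
X = shift (const 1ℚ)

X-⊛ : ∀ f → X ⊛ f ≐ shift f
X-⊛ f zero    = *-zeroˡ (f 0)
X-⊛ f (suc m) = begin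
  0ℚ * f (suc m) + (const 1ℚ ⊛ f) m ≡⟨ cong₂ _+_ (*-zeroˡ (f (suc m))) (const-⊛ 1ℚ f m) ⟩
  0ℚ + 1ℚ * f m                     ≡⟨ +-identityˡ _ ⟩
  1ℚ * f m                          ≡⟨ *-identityˡ _ ⟩
  f m                               ∎
  where open ≡-Reasoning

⊛-identityˡ : ∀ f → const 1ℚ ⊛ f ≐ f
⊛-identityˡ f m = trans (const-⊛ 1ℚ f m) (*-identityˡ (f m))

seriesRing : CommutativeRing 0ℓ 0ℓ
seriesRing = record
  { Carrier = Series
  ; _≈_ = _≐_
  ; _+_ = _⊕_
  ; _*_ = _⊛_
  ; -_  = λ f m → - f m
  ; 0#  = λ _ → 0ℚ
  ; 1#  = const 1ℚ
  ; isCommutativeRing = record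
    { isRing = record
      { +-isAbelianGroup = record
        { isGroup = record
          { isMonoid = record
            { isSemigroup = record
              { isMagma = record
                { isEquivalence = record
                  { refl  = λ _ → refl
                  ; sym   = λ p m → sym (p m)
                  ; trans = λ p q m → trans (p m) (q m)
                  }
                ; ∙-cong = λ p q m → cong₂ _+_ (p m) (q m)
                }
              ; assoc = λ f g h m → +-assoc (f m) (g m) (h m)
              }
            ; identity = (λ f m → +-identityˡ (f m)) , (λ f m → +-identityʳ (f m))
            }
          ; inverse = (λ f m → +-inverseˡ (f m)) , (λ f m → +-inverseʳ (f m))
          ; ⁻¹-cong = λ p m → cong -_ (p m)
          }
        ; comm = λ f g m → +-comm (f m) (g m)
        }
      ; *-cong     = ⊛-cong
      ; *-assoc    = ⊛-assoc
      ; *-identity = ⊛-identityˡ , λ f m → trans (⊛-comm f (const 1ℚ) m) (⊛-identityˡ f m)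
      ; distrib    = ⊛-distribˡ , ⊛-distribʳ
      }
    ; *-comm = ⊛-comm
    }
  }

-- Natural numbers and their reciprocals in the rationals.

fromℕ-+ : ∀ m n → fromℕ (m ℕ.+ n) ≡ fromℕ m + fromℕ n
fromℕ-+ m n = toℚᵘ-injective (begin
  toℚᵘ (fromℕ (m ℕ.+ n))                     ≈⟨ toℚᵘ-fromℚᵘ (ℚᵘ.mkℚᵘ (ℤ.+ (m ℕ.+ n)) 0) ⟩
  ℚᵘ.mkℚᵘ (ℤ.+ (m ℕ.+ n)) 0                    ≈⟨ ℚᵘ.*≡* (cong (ℤ._* ℤ.+ 1)
                                                  (cong₂ ℤ._+_ (ℤ.*-identityʳ (ℤ.+ m)) (ℤ.*-identityʳ (ℤ.+ n)))) ⟨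
  ℚᵘ.mkℚᵘ (ℤ.+ m) 0 ℚᵘ.+ ℚᵘ.mkℚᵘ (ℤ.+ n) 0       ≈⟨ ℚᵘ.+-cong (toℚᵘ-fromℚᵘ (ℚᵘ.mkℚᵘ (ℤ.+ m) 0))
                                                  (toℚᵘ-fromℚᵘ (ℚᵘ.mkℚᵘ (ℤ.+ n) 0)) ⟨
  toℚᵘ (fromℕ m) ℚᵘ.+ toℚᵘ (fromℕ n)         ≈⟨ toℚᵘ-homo-+ (fromℕ m) (fromℕ n) ⟨
  toℚᵘ (fromℕ m + fromℕ n)                   ∎)
  where open ℚᵘ.≃-Reasoning

fromℕ-* : ∀ m n → fromℕ (m ℕ.* n) ≡ fromℕ m * fromℕ n
fromℕ-* zero    n = sym (*-zeroˡ (fromℕ n))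
fromℕ-* (suc m) n = begin
  fromℕ (n ℕ.+ m ℕ.* n)                 ≡⟨ fromℕ-+ n (m ℕ.* n) ⟩
  fromℕ n + fromℕ (m ℕ.* n)             ≡⟨ cong₂ _+_ (sym (*-identityˡ (fromℕ n))) (fromℕ-* m n) ⟩
  1ℚ * fromℕ n + fromℕ m * fromℕ n      ≡⟨ *-distribʳ-+ (fromℕ n) 1ℚ (fromℕ m) ⟨
  (1ℚ + fromℕ m) * fromℕ n              ≡⟨ cong (_* fromℕ n) (fromℕ-+ 1 m) ⟨
  fromℕ (suc m) * fromℕ n               ∎
  where open ≡-Reasoning

1/n*n : ∀ n .{{_ : NonZero n}} → (ℤ.+ 1 / n) * fromℕ n ≡ 1ℚ
1/n*n n@(suc n-1) = toℚᵘ-injective (begin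
  toℚᵘ ((ℤ.+ 1 / n) * fromℕ n)                       ≈⟨ toℚᵘ-homo-* (ℤ.+ 1 / n) (fromℕ n) ⟩
  toℚᵘ (ℤ.+ 1 / n) ℚᵘ.* toℚᵘ (fromℕ n)               ≈⟨ ℚᵘ.*-cong (toℚᵘ-fromℚᵘ (ℚᵘ.mkℚᵘ (ℤ.+ 1) n-1))
                                                        (toℚᵘ-fromℚᵘ (ℚᵘ.mkℚᵘ (ℤ.+ n) 0)) ⟩
  ℚᵘ.mkℚᵘ (ℤ.+ 1) n-1 ℚᵘ.* ℚᵘ.mkℚᵘ (ℤ.+ n) 0           ≈⟨ ℚᵘ.*≡* (cong ℤ.+_
    (trans (ℕ.*-identityʳ _) (trans (ℕ.*-comm 1 n) (sym (ℕ.+-identityʳ _))))) ⟩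
  toℚᵘ 1ℚ                                          ∎)
  where open ℚᵘ.≃-Reasoning

module 𝕊 = CommutativeRing seriesRing

1-X : Series
1-X = 𝕊._-_ 𝕊.1# X

1-X+X≐1 : 1-X ⊕ X ≐ const 1ℚ
1-X+X≐1 = 𝕊.trans (𝕊.+-assoc 𝕊.1# (𝕊.- X) X) (𝕊.trans (𝕊.+-congˡ {𝕊.1#} (𝕊.-‿inverseˡ X)) (𝕊.+-identityʳ 𝕊.1#))

open Weights seriesRing X 1-X 1-X+X≐1

length-∖ : ∀ {n} {F : List (Fin n)} {s} → Unique F → s ∈ F → length F ≡ suc (length (F ∖ s))
length-∖ {F = t ∷ F} {s} (t∉ ∷ uF) s∈ with t ≟ᶠ s | s∈
... | yes refl | _          = cong (suc ∘ length) (sym (filter-all _ (All.map (_∘ sym) t∉)))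
... | no  t≢s  | here refl  = contradiction refl t≢s
... | no  t≢s  | there s∈F  = cong suc (length-∖ uF s∈F)

-- Probabilities and the generating function of a boarding.

module _ {a p} {A : Set a} {E : Pred A p} (E? : Decidable E) where

  Pr-∷ : ∀ w x d → Pr E? ((w , x) ∷ d) ≡ (if does (E? x) then w else 0ℚ) + Pr E? d
  Pr-∷ w x d with does (E? x)
  ... | true  = refl
  ... | false = sym (+-identityˡ _)

  Pr-++ : ∀ d e → Pr E? (d ++ e) ≡ Pr E? d + Pr E? e
  Pr-++ []            e = sym (+-identityˡ _)
  Pr-++ ((w , x) ∷ d) e = begin
    Pr E? ((w , x) ∷ d ++ e)                                    ≡⟨ Pr-∷ w x (d ++ e) ⟩
    (if does (E? x) then w else 0ℚ) + Pr E? (d ++ e)            ≡⟨ cong ((if does (E? x) then w else 0ℚ) +_) (Pr-++ d e) ⟩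
    (if does (E? x) then w else 0ℚ) + (Pr E? d + Pr E? e)       ≡⟨ +-assoc (if does (E? x) then w else 0ℚ) (Pr E? d) (Pr E? e) ⟨
    (if does (E? x) then w else 0ℚ) + Pr E? d + Pr E? e         ≡⟨ cong (_+ Pr E? e) (Pr-∷ w x d) ⟨
    Pr E? ((w , x) ∷ d) + Pr E? e                               ∎
    where open ≡-Reasoning

  Pr-scale : ∀ w d → Pr E? (map (λ (v , x) → w * v , x) d) ≡ w * Pr E? d
  Pr-scale w []            = sym (*-zeroʳ w)
  Pr-scale w ((v , x) ∷ d) with does (E? x)
  ... | true  = trans (cong (w * v +_) (Pr-scale w d)) (sym (*-distribˡ-+ w v (Pr E? d)))
  ... | false = Pr-scale w d

  Pr-cong : ∀ {q} {E′ : Pred A q} (E′? : Decidable E′) →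
            (∀ x → does (E? x) ≡ does (E′? x)) → ∀ d → Pr E? d ≡ Pr E′? d
  Pr-cong E′? eq []            = refl
  Pr-cong E′? eq ((w , x) ∷ d) with does (E? x) | does (E′? x) | eq x
  ... | true  | true  | _ = cong (w +_) (Pr-cong E′? eq d)
  ... | false | false | _ = Pr-cong E′? eq d

  Pr-none : (∀ x → does (E? x) ≡ false) → ∀ d → Pr E? d ≡ 0ℚ
  Pr-none none []            = refl
  Pr-none none ((w , x) ∷ d) rewrite none x = Pr-none none d

  Pr->>= : ∀ {b} {B : Set b} (d : Dist B) (f : B → Dist A) →
           Pr E? (d >>= f) ≡ foldr (λ (w , x) r → w * Pr E? (f x) + r) 0ℚ d
  Pr->>= []            f = refl
  Pr->>= ((w , x) ∷ d) f = trans (Pr-++ (map (λ (v , y) → w * v , y) (f x)) (d >>= f))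
                                 (cong₂ _+_ (Pr-scale w (f x)) (Pr->>= d f))

  Pr-return : ∀ {b} {B : Set b} (g : B → A) (d : Dist B) →
              Pr E? (d >>= (return ∘ g)) ≡ Pr (E? ∘ g) d
  Pr-return g []            = refl
  Pr-return g ((w , x) ∷ d) with does (E? (g x))
  ... | true  = cong₂ _+_ (*-identityʳ w) (Pr-return g d)
  ... | false = Pr-return g d

gf : ∀ {n} → Dist (List (Fin n × Fin n)) → Series
gf d m = Pr (λ seating → misseated seating ℕ.≟ m) d

ι-⊛ : ∀ n f → ι n ⊛ f ≐ (λ m → fromℕ n * f m)
ι-⊛ zero    f m = trans (⊛-zeroˡ f m) (sym (*-zeroˡ (f m)))
ι-⊛ (suc n) f m = begin
  (ι (suc n) ⊛ f) m             ≡⟨ ⊛-distribʳ f (const 1ℚ) (ι n) m ⟩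
  (const 1ℚ ⊛ f) m + (ι n ⊛ f) m  ≡⟨ cong₂ _+_ (const-⊛ 1ℚ f m) (ι-⊛ n f m) ⟩
  1ℚ * f m + fromℕ n * f m      ≡⟨ *-distribʳ-+ (f m) 1ℚ (fromℕ n) ⟨
  (1ℚ + fromℕ n) * f m          ≡⟨ cong (_* f m) (fromℕ-+ 1 n) ⟨
  fromℕ (suc n) * f m           ∎
  where open ≡-Reasoning

-- A misseated passenger raises the count by one, which shifts the coefficients and so multiplies by
-- X.
gf-∷ : ∀ {n} k (i s : Fin n) d → gf (d >>= λ rest → return ((i , s) ∷ rest)) ≐ cost k i s (gf d)
gf-∷ k i s d m = trans (Pr-return (λ seating → misseated seating ℕ.≟ m) ((i , s) ∷_) d) (step m)
  where
  step : ∀ m → Pr (λ rest → misseated ((i , s) ∷ rest) ℕ.≟ m) d ≡ cost k i s (gf d) m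
  step m with does (s ≟ᶠ i)
  ... | true  = refl
  step zero    | false = trans (Pr-none _ (λ _ → refl) d) (sym (X-⊛ (gf d) 0))
  step (suc m) | false = trans (Pr-cong _ (λ rest → misseated rest ℕ.≟ m) (λ _ → refl) d)
                               (sym (X-⊛ (gf d) (suc m)))

-- The factor |F| clears the probability 1/|F|. For the empty list both sides are zero.
gf-uniform : ∀ {n} (F : List (Fin n)) (g : Fin n → Dist (List (Fin n × Fin n))) →
             ι (length F) ⊛ gf (uniform F >>= g) ≐ sumOver F (gf ∘ g)
gf-uniform []         g = ⊛-zeroˡ _
gf-uniform F@(_ ∷ F′) g m = begin
  (ι (length F) ⊛ gf (uniform F >>= g)) m
    ≡⟨ ι-⊛ (length F) (gf (uniform F >>= g)) m ⟩
  fromℕ (length F) * gf (uniform F >>= g) m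
    ≡⟨ cong (fromℕ (length F) *_) (Pr->>= _ (uniform F) g) ⟩
  fromℕ (length F) * foldr (λ (w , s) r → w * gf (g s) m + r) 0ℚ (map (λ s → u , s) F)
    ≡⟨ cong (fromℕ (length F) *_) (factor F) ⟩
  fromℕ (length F) * (u * sumOver F (gf ∘ g) m)
    ≡⟨ *-assoc (fromℕ (length F)) u _ ⟨
  fromℕ (length F) * u * sumOver F (gf ∘ g) m
    ≡⟨ cong (_* sumOver F (gf ∘ g) m) (trans (*-comm (fromℕ (length F)) u) (1/n*n (length F))) ⟩
  1ℚ * sumOver F (gf ∘ g) m
    ≡⟨ *-identityˡ _ ⟩
  sumOver F (gf ∘ g) m ∎
  where
  open ≡-Reasoning
  u = ℤ.+ 1 / length F
  factor : ∀ xs → foldr (λ (w , s) r → w * gf (g s) m + r) 0ℚ (map (λ s → u , s) xs) ≡ u * sumOver xs (gf ∘ g) m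
  factor []       = sym (*-zeroʳ u)
  factor (s ∷ xs) = trans (cong (u * gf (g s) m +_) (factor xs))
                          (sym (*-distribˡ-+ u (gf (g s) m) (sumOver xs (gf ∘ g) m)))

gf-return->>= : ∀ {n} {b} {B : Set b} (s : B) (g : B → Dist (List (Fin n × Fin n))) → gf (return s >>= g) ≐ gf (g s)
gf-return->>= s g m = trans (Pr->>= _ (return s) g) (trans (+-identityʳ _) (*-identityˡ _))

chooseSeat-absent : ∀ {n} k (i : Fin n) F → absent k i ≡ true → chooseSeat k F i ≡ uniform F
chooseSeat-absent k i F abs rewrite abs = refl

chooseSeat-taken : ∀ {n} k {i : Fin n} F → absent k i ≡ false → i ∉ F → chooseSeat k F i ≡ uniform F
chooseSeat-taken k {i} F att i∉F rewrite att | dec-false (_∈?_ _≟ᶠ_ i F) i∉F = refl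

chooseSeat-own : ∀ {n} k {i : Fin n} F → absent k i ≡ false → i ∈ F → chooseSeat k F i ≡ return i
chooseSeat-own k {i} F att i∈F rewrite att | dec-true (_∈?_ _≟ᶠ_ i F) i∈F = refl

-- Of the factorial, |F| = |Q| cancels the uniform choice of the first passenger, and the factorial
-- of the remaining queue goes to the induction hypothesis.
gf-board : ∀ {n} k (Q F : List (Fin n)) → Unique Q → Unique F → length F ≡ length Q →
           ι (length Q !) ⊛ gf (board k Q F) ≐ weight k Q 0 F
gf-board k []      F _ _ _ m = trans (ι-⊛ 1 (gf (return [])) m) (trans (*-identityˡ _) (base m))
  where
  base : ∀ m → gf (return []) m ≡ ι 1 m
  base zero    = refl
  base (suc m) = refl
gf-board {n} k (i ∷ Q) F uiQ@(i∉ ∷ uQ) uF eq = go (absent k i) refl (_∈?_ _≟ᶠ_ i F)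
  where
  open Relation.Binary.Reasoning.Setoid 𝕊.setoid
  open Algebra.Properties.Semiring.Mult 𝕊.semiring using (×1-homo-*)

  step : Fin n → Dist (List (Fin n × Fin n))
  step s = board k Q (F ∖ s) >>= λ rest → return ((i , s) ∷ rest)

  scale-cost : ∀ {s f g} r → r ⊛ f ≐ g → r ⊛ cost k i s f ≐ cost k i s g
  scale-cost {s} {f} r eq with does (s ≟ᶠ i)
  ... | true  = eq
  ... | false = 𝕊.trans (𝕊.sym (𝕊.*-assoc r X f))
                (𝕊.trans (𝕊.*-congʳ {f} (𝕊.*-comm r X))
                (𝕊.trans (𝕊.*-assoc X r f) (𝕊.*-congˡ {X} eq)))

  scaled-step : ∀ {s} → s ∈ F → ι (length Q !) ⊛ gf (step s) ≐ cost k i s (weight k Q 0 (F ∖ s))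
  scaled-step {s} s∈ = 𝕊.trans (𝕊.*-congˡ {ι (length Q !)} (gf-∷ k i s (board k Q (F ∖ s))))
    (scale-cost {s} {gf (board k Q (F ∖ s))} {weight k Q 0 (F ∖ s)} (ι (length Q !)) (gf-board k Q (F ∖ s) uQ (Unique.filter⁺ _ uF)
      (ℕ.suc-injective (trans (sym (length-∖ uF s∈)) eq))))

  first : ∀ f → ι (length (i ∷ Q) !) ⊛ f ≐ ι (length Q !) ⊛ (ι (suc (length Q)) ⊛ f)
  first f = begin
    ι (suc (length Q) !) ⊛ f                       ≈⟨ 𝕊.*-congʳ {f} (×1-homo-* (suc (length Q)) (length Q !)) ⟩
    ι (suc (length Q)) ⊛ ι (length Q !) ⊛ f        ≈⟨ 𝕊.*-congʳ {f} (𝕊.*-comm (ι (suc (length Q))) (ι (length Q !))) ⟩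
    ι (length Q !) ⊛ ι (suc (length Q)) ⊛ f        ≈⟨ 𝕊.*-assoc (ι (length Q !)) (ι (suc (length Q))) f ⟩
    ι (length Q !) ⊛ (ι (suc (length Q)) ⊛ f)      ∎

  scaled-uniform : ι (length (i ∷ Q) !) ⊛ gf (uniform F >>= step)
                   ≐ sumOver F (λ s → cost k i s (weight k Q 0 (F ∖ s)))
  scaled-uniform = begin
    ι (length (i ∷ Q) !) ⊛ gf (uniform F >>= step)
      ≈⟨ first (gf (uniform F >>= step)) ⟩
    ι (length Q !) ⊛ (ι (suc (length Q)) ⊛ gf (uniform F >>= step))
      ≡⟨ cong (λ l → ι (length Q !) ⊛ (ι l ⊛ gf (uniform F >>= step))) eq ⟨
    ι (length Q !) ⊛ (ι (length F) ⊛ gf (uniform F >>= step))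
      ≈⟨ 𝕊.*-congˡ {ι (length Q !)} (gf-uniform F step) ⟩
    ι (length Q !) ⊛ sumOver F (gf ∘ step)
      ≈⟨ sumOver-*ˡ (ι (length Q !)) (gf ∘ step) F ⟨
    sumOver F (λ s → ι (length Q !) ⊛ gf (step s))
      ≈⟨ sumOver-cong F scaled-step ⟩
    sumOver F (λ s → cost k i s (weight k Q 0 (F ∖ s))) ∎

  via : ∀ {d} → chooseSeat k F i ≡ d → ι (length (i ∷ Q) !) ⊛ gf (d >>= step) ≐ weight k (i ∷ Q) 0 F →
        ι (length (i ∷ Q) !) ⊛ gf (chooseSeat k F i >>= step) ≐ weight k (i ∷ Q) 0 F
  via refl p = p

  go : ∀ b → absent k i ≡ b → Dec (i ∈ F) →
       ι (length (i ∷ Q) !) ⊛ gf (chooseSeat k F i >>= step) ≐ weight k (i ∷ Q) 0 F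
  go true  abs _         = via (chooseSeat-absent k i F abs)
    (𝕊.trans scaled-uniform (sum-cost-absent k Q uiQ uF eq abs))
  go false att (no i∉F)  = via (chooseSeat-taken k F att i∉F)
    (𝕊.trans scaled-uniform (sum-cost-taken k Q uiQ uF eq i∉F))
  go false att (yes i∈F) = via (chooseSeat-own k F att i∈F) (begin
    ι (length (i ∷ Q) !) ⊛ gf (return i >>= step)
      ≈⟨ 𝕊.*-congˡ {ι (length (i ∷ Q) !)} (gf-return->>= i step) ⟩
    ι (length (i ∷ Q) !) ⊛ gf (step i)
      ≈⟨ 𝕊.*-congʳ {gf (step i)} (×1-homo-* (suc (length Q)) (length Q !)) ⟩
    ι (suc (length Q)) ⊛ ι (length Q !) ⊛ gf (step i)
      ≈⟨ 𝕊.*-assoc (ι (suc (length Q))) (ι (length Q !)) (gf (step i)) ⟩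
    ι (suc (length Q)) ⊛ (ι (length Q !) ⊛ gf (step i))
      ≈⟨ 𝕊.*-congˡ {ι (suc (length Q))} (scaled-step i∈F) ⟩
    ι (suc (length Q)) ⊛ cost k i i (weight k Q 0 (F ∖ i))
      ≈⟨ own-weight k Q (λ i∈ → All.lookup i∉ i∈ refl) i∈F att ⟩
    weight k (i ∷ Q) 0 F ∎)

open ≡-Reasoning

ι-const : ∀ n → ι n ≐ const (fromℕ n)
ι-const n m = begin
  ι n m                     ≡⟨ 𝕊.sym (𝕊.*-identityʳ (ι n)) m ⟩
  (ι n ⊛ const 1ℚ) m        ≡⟨ ι-⊛ n (const 1ℚ) m ⟩
  fromℕ n * const 1ℚ m      ≡⟨ scaled m ⟩
  const (fromℕ n) m         ∎
  where
  scaled : ∀ m → fromℕ n * const 1ℚ m ≡ const (fromℕ n) m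
  scaled zero    = *-identityʳ (fromℕ n)
  scaled (suc m) = *-zeroʳ (fromℕ n)

-- The weight when every own seat is free.

freeWeight : ℕ → ℕ → ℕ → Series
freeWeight zero    zero    h = ι (h !)
freeWeight zero    (suc r) h = (ι (suc r) ⊕ ι h ⊛ X) ⊛ freeWeight zero r h
freeWeight (suc k) r       h = 1-X ⊛ freeWeight k r h ⊕ X ⊛ freeWeight k r (suc h)

-- `k′` is fixed by the model, while `k` counts the absent-minded passengers left in the queue. The
-- map `f` is arbitrary so that the tail of the queue, `f ∘ suc`, is again an instance; `F` can stay
-- the full list, since the weight never removes a seat.
weight-allFree : ∀ {n k′} (F : List (Fin n)) → (∀ i → i ∈ F) →
  ∀ k r (f : Fin (k ℕ.+ r) → Fin n) → (∀ i → absent k′ (f i) ≡ does (toℕ i ℕ.<? k)) →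
  ∀ h → weight k′ (tabulate f) h F ≐ freeWeight k r h
weight-allFree F free zero    zero    f abs h m = refl
weight-allFree {k′ = k′} F free zero    (suc r) f abs h = 𝕊.trans
  (𝕊.reflexive (trans (weight-free k′ (tabulate f′) h (free (f Fin.zero)))
    (cong₂ (λ b c → stay b (suc c) h ⊛ weight k′ (tabulate f′) h F ⊕ leave b ⊛ weight k′ (tabulate f′) (suc h) F)
           (abs Fin.zero) (length-tabulate f′))))
  (𝕊.trans (𝕊.+-cong (𝕊.*-congˡ {ι (suc r) ⊕ ι h ⊛ X} (weight-allFree F free zero r f′ (abs ∘ Fin.suc) h))
                     (𝕊.zeroˡ (weight k′ (tabulate f′) (suc h) F)))
           (𝕊.+-identityʳ _))
  where f′ = f ∘ Fin.suc
weight-allFree {k′ = k′} F free (suc k) r f abs h = 𝕊.trans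
  (𝕊.reflexive (trans (weight-free k′ (tabulate f′) h (free (f Fin.zero)))
    (cong (λ b → stay b (suc (length (tabulate f′))) h ⊛ weight k′ (tabulate f′) h F ⊕ leave b ⊛ weight k′ (tabulate f′) (suc h) F)
           (abs Fin.zero))))
  (𝕊.+-cong (𝕊.*-congˡ {1-X} (weight-allFree F free k r f′ (abs ∘ Fin.suc) h))
            (𝕊.*-congˡ {X} (weight-allFree F free k r f′ (abs ∘ Fin.suc) (suc h))))
  where f′ = f ∘ Fin.suc

P-freeWeight : ∀ k r m → fromℕ ((k ℕ.+ r) !) * P (k ℕ.+ r) k m ≡ freeWeight k r 0 m
P-freeWeight k r m = begin
  fromℕ (n !) * P n k m                             ≡⟨ ι-⊛ (n !) (gf (board k (allFin n) (allFin n))) m ⟨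
  (ι (n !) ⊛ gf (board k (allFin n) (allFin n))) m  ≡⟨ cong (λ l → (ι (l !) ⊛ gf (board k (allFin n) (allFin n))) m)
                                                            (length-tabulate {n = n} (λ i → i)) ⟨
  (ι (length (allFin n) !) ⊛ gf (board k (allFin n) (allFin n))) m
    ≡⟨ gf-board k (allFin n) (allFin n) (Unique.allFin⁺ n) (Unique.allFin⁺ n) refl m ⟩
  weight k (allFin n) 0 (allFin n) m                     ≡⟨ weight-allFree (allFin n) ∈-allFin k r (λ i → i) (λ _ → refl) 0 m ⟩
  freeWeight k r 0 m                                         ∎
  where n = k ℕ.+ r

attentive-zero : ∀ r h f → ((ι (suc r) ⊕ ι h ⊛ X) ⊛ f) 0 ≡ fromℕ (suc r) * f 0
attentive-zero r h f = begin
  ((ι (suc r) ⊕ ι h ⊛ X) ⊛ f) 0           ≡⟨ ⊛-distribʳ f (ι (suc r)) (ι h ⊛ X) 0 ⟩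
  (ι (suc r) ⊛ f) 0 + (ι h ⊛ X ⊛ f) 0     ≡⟨ cong₂ _+_ (ι-⊛ (suc r) f 0)
                                               (trans (⊛-assoc (ι h) X f 0) (trans (ι-⊛ h (X ⊛ f) 0)
                                                 (cong (fromℕ h *_) (X-⊛ f 0)))) ⟩
  fromℕ (suc r) * f 0 + fromℕ h * 0ℚ      ≡⟨ cong (fromℕ (suc r) * f 0 +_) (*-zeroʳ (fromℕ h)) ⟩
  fromℕ (suc r) * f 0 + 0ℚ                ≡⟨ +-identityʳ _ ⟩
  fromℕ (suc r) * f 0                     ∎

attentive-suc : ∀ r h f m → ((ι (suc r) ⊕ ι h ⊛ X) ⊛ f) (suc m) ≡ fromℕ (suc r) * f (suc m) + fromℕ h * f m
attentive-suc r h f m = begin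
  ((ι (suc r) ⊕ ι h ⊛ X) ⊛ f) (suc m)               ≡⟨ ⊛-distribʳ f (ι (suc r)) (ι h ⊛ X) (suc m) ⟩
  (ι (suc r) ⊛ f) (suc m) + (ι h ⊛ X ⊛ f) (suc m)   ≡⟨ cong₂ _+_ (ι-⊛ (suc r) f (suc m))
                                                         (trans (⊛-assoc (ι h) X f (suc m)) (trans (ι-⊛ h (X ⊛ f) (suc m))
                                                           (cong (fromℕ h *_) (X-⊛ f (suc m))))) ⟩
  fromℕ (suc r) * f (suc m) + fromℕ h * f m         ∎

-- The rising factorial z(z+1)...(z+r) has the Stirling numbers of r + 1 as coefficients. Dividing
-- by z shifts the lower index by one, and then z = hx. At `h = 0` the constant coefficient relies
-- on 0^0 = 1.
freeWeight-attentive : ∀ r h m → freeWeight zero r h m ≡ fromℕ (h ! ℕ.* (stirling₁ (suc r) (ℤ.+ suc m) ℕ.* h ℕ.^ m))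
freeWeight-attentive zero    h zero    = trans (ι-const (h !) 0) (cong fromℕ (sym (ℕ.*-identityʳ (h !))))
freeWeight-attentive zero    h (suc m) = begin
  ι (h !) (suc m)   ≡⟨ ι-const (h !) (suc m) ⟩
  0ℚ                ≡⟨ cong fromℕ (ℕ.*-zeroʳ (h !)) ⟨
  fromℕ (h ! ℕ.* 0) ≡⟨ cong (λ c → fromℕ (h ! ℕ.* (c ℕ.* h ℕ.^ suc m))) (stirling₁-suc 0 (suc m)) ⟨
  fromℕ (h ! ℕ.* (stirling₁ 1 (ℤ.+ suc (suc m)) ℕ.* h ℕ.^ suc m)) ∎
freeWeight-attentive (suc r) h zero = begin
  ((ι (suc r) ⊕ ι h ⊛ X) ⊛ freeWeight zero r h) 0            ≡⟨ attentive-zero r h (freeWeight zero r h) ⟩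
  fromℕ (suc r) * freeWeight zero r h 0                      ≡⟨ cong (fromℕ (suc r) *_) (freeWeight-attentive r h 0) ⟩
  fromℕ (suc r) * fromℕ (h ! ℕ.* (c ℕ.* 1))         ≡⟨ fromℕ-* (suc r) (h ! ℕ.* (c ℕ.* 1)) ⟨
  fromℕ (suc r ℕ.* (h ! ℕ.* (c ℕ.* 1)))             ≡⟨ cong fromℕ (solve 3 (λ r h c →
                                                         r :* (h :* (c :* con 1)) := h :* ((con 0 :+ r :* c) :* con 1))
                                                         refl (suc r) (h !) c) ⟩
  -- The summand 0 was inserted to be read as the Stirling number of lower index 0 in the
  -- recurrence.
  fromℕ (h ! ℕ.* ((0 ℕ.+ suc r ℕ.* c) ℕ.* 1))       ≡⟨ cong (λ z → fromℕ (h ! ℕ.* ((z ℕ.+ suc r ℕ.* c) ℕ.* 1))) (stirling₁-zero r) ⟨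
  fromℕ (h ! ℕ.* ((stirling₁ (suc r) (ℤ.+ 0) ℕ.+ suc r ℕ.* c) ℕ.* 1))
    ≡⟨ cong (λ z → fromℕ (h ! ℕ.* (z ℕ.* 1))) (stirling₁-suc (suc r) 0) ⟨
  fromℕ (h ! ℕ.* (stirling₁ (suc (suc r)) (ℤ.+ 1) ℕ.* 1)) ∎
  where
  open ℕ.+-*-Solver
  c = stirling₁ (suc r) (ℤ.+ 1)
freeWeight-attentive (suc r) h (suc m) = begin
  ((ι (suc r) ⊕ ι h ⊛ X) ⊛ freeWeight zero r h) (suc m)
    ≡⟨ attentive-suc r h (freeWeight zero r h) m ⟩
  fromℕ (suc r) * freeWeight zero r h (suc m) + fromℕ h * freeWeight zero r h m
    ≡⟨ cong₂ (λ p q → fromℕ (suc r) * p + fromℕ h * q) (freeWeight-attentive r h (suc m)) (freeWeight-attentive r h m) ⟩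
  fromℕ (suc r) * fromℕ (h ! ℕ.* (c′ ℕ.* h ℕ.^ suc m)) + fromℕ h * fromℕ (h ! ℕ.* (c ℕ.* h ℕ.^ m))
    ≡⟨ cong₂ _+_ (fromℕ-* (suc r) (h ! ℕ.* (c′ ℕ.* h ℕ.^ suc m))) (fromℕ-* h (h ! ℕ.* (c ℕ.* h ℕ.^ m))) ⟨
  fromℕ (suc r ℕ.* (h ! ℕ.* (c′ ℕ.* h ℕ.^ suc m))) + fromℕ (h ℕ.* (h ! ℕ.* (c ℕ.* h ℕ.^ m)))
    ≡⟨ fromℕ-+ (suc r ℕ.* (h ! ℕ.* (c′ ℕ.* h ℕ.^ suc m))) (h ℕ.* (h ! ℕ.* (c ℕ.* h ℕ.^ m))) ⟨
  fromℕ (suc r ℕ.* (h ! ℕ.* (c′ ℕ.* h ℕ.^ suc m)) ℕ.+ h ℕ.* (h ! ℕ.* (c ℕ.* h ℕ.^ m)))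
    ≡⟨ cong fromℕ (solve 6 (λ r h! h p c c′ →
         r :* (h! :* (c′ :* (h :* p))) :+ h :* (h! :* (c :* p)) := h! :* ((c :+ r :* c′) :* (h :* p)))
         refl (suc r) (h !) h (h ℕ.^ m) c c′) ⟩
  fromℕ (h ! ℕ.* ((c ℕ.+ suc r ℕ.* c′) ℕ.* h ℕ.^ suc m))
    ≡⟨ cong (λ z → fromℕ (h ! ℕ.* (z ℕ.* h ℕ.^ suc m))) (stirling₁-suc (suc r) (suc m)) ⟨
  fromℕ (h ! ℕ.* (stirling₁ (suc (suc r)) (ℤ.+ suc (suc m)) ℕ.* h ℕ.^ suc m)) ∎
  where
  open ℕ.+-*-Solver
  c  = stirling₁ (suc r) (ℤ.+ suc m)
  c′ = stirling₁ (suc r) (ℤ.+ suc (suc m))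

∑[0≤i≤_] : ℕ → (ℕ → ℚ) → ℚ
∑[0≤i≤ n ] f = f 0 + ∑[1≤i≤ n ] λ i → f i

∑₁-cong : ∀ n {f g : ∀ i → .{{NonZero i}} → ℚ} → (∀ i → suc i ℕ.≤ n → f (suc i) ≡ g (suc i)) →
          ∑[1≤i≤ n ] f ≡ ∑[1≤i≤ n ] g
∑₁-cong zero    eq = refl
∑₁-cong (suc n) {f} {g} eq = cong₂ _+_ (eq 0 (s≤s z≤n)) (∑₁-cong n {λ i → f (suc i)} {λ i → g (suc i)} λ i i<n → eq (suc i) (s≤s i<n))

∑₁-*ˡ : ∀ n q (f : ∀ i → .{{NonZero i}} → ℚ) → ∑[1≤i≤ n ] (λ i → q * f i) ≡ q * ∑[1≤i≤ n ] f
∑₁-*ˡ zero    q f = sym (*-zeroʳ q)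
∑₁-*ˡ (suc n) q f = trans (cong (q * f 1 +_) (∑₁-*ˡ n q (λ i → f (suc i))))
                          (sym (*-distribˡ-+ q (f 1) (∑[1≤i≤ n ] λ i → f (suc i))))

∑-cong : ∀ n {f g : ℕ → ℚ} → (∀ i → i ℕ.≤ n → f i ≡ g i) → ∑[0≤i≤ n ] f ≡ ∑[0≤i≤ n ] g
∑-cong n {f} {g} eq = cong₂ _+_ (eq 0 z≤n) (∑₁-cong n {λ i → f i} {λ i → g i} (λ i → eq (suc i)))

∑-*ˡ : ∀ n q f → ∑[0≤i≤ n ] (λ i → q * f i) ≡ q * ∑[0≤i≤ n ] f
∑-*ˡ n q f = trans (cong (q * f 0 +_) (∑₁-*ˡ n q (λ i → f i))) (sym (*-distribˡ-+ q (f 0) (∑[1≤i≤ n ] λ i → f i)))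

∑-+ : ∀ n f g → ∑[0≤i≤ n ] (λ i → f i + g i) ≡ ∑[0≤i≤ n ] f + ∑[0≤i≤ n ] g
∑-+ zero    f g = solve 2 (λ a b → a :+ b :+ con 0ℚ := a :+ con 0ℚ :+ (b :+ con 0ℚ)) refl (f 0) (g 0)
  where open +-*-Solver
∑-+ (suc n) f g = trans (cong (f 0 + g 0 +_) (∑-+ n (f ∘ suc) (g ∘ suc)))
  (solve 4 (λ a b c d → a :+ b :+ (c :+ d) := a :+ c :+ (b :+ d)) refl (f 0) (g 0) (∑[0≤i≤ n ] (f ∘ suc)) (∑[0≤i≤ n ] (g ∘ suc)))
  where open +-*-Solver

∑-last : ∀ n f → ∑[0≤i≤ suc n ] f ≡ ∑[0≤i≤ n ] f + f (suc n)
∑-last zero    f = solve 2 (λ a b → a :+ (b :+ con 0ℚ) := a :+ con 0ℚ :+ b) refl (f 0) (f 1)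
  where open +-*-Solver
∑-last (suc n) f = trans (cong (f 0 +_) (∑-last n (f ∘ suc)))
  (sym (+-assoc (f 0) (∑[0≤i≤ n ] (f ∘ suc)) (f (suc (suc n)))))

δ : ℕ → ℕ → ℚ
δ zero    zero    = 1ℚ
δ zero    (suc _) = 0ℚ
δ (suc _) zero    = 0ℚ
δ (suc m) (suc s) = δ m s

-- For `m` beyond the range the sum is 0, so `g m` has to be 0 too; in the application this is
-- `k C m` with m > k.
∑-δ : ∀ n m (g : ℕ → ℚ) → (n ℕ.< m → g m ≡ 0ℚ) → ∑[0≤i≤ n ] (λ s → δ m s * g s) ≡ g m
∑-δ zero    zero    g _    = trans (+-identityʳ (1ℚ * g 0)) (*-identityˡ (g 0))
∑-δ zero    (suc m) g zero′ = trans (+-identityʳ (0ℚ * g 0)) (trans (*-zeroˡ (g 0)) (sym (zero′ (s≤s z≤n))))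
∑-δ (suc n) zero    g _    = begin
  1ℚ * g 0 + ∑[0≤i≤ n ] (λ s → 0ℚ * g (suc s))  ≡⟨ cong₂ _+_ (*-identityˡ (g 0)) (∑-*ˡ n 0ℚ (g ∘ suc)) ⟩
  g 0 + 0ℚ * ∑[0≤i≤ n ] (g ∘ suc)               ≡⟨ cong (g 0 +_) (*-zeroˡ (∑[0≤i≤ n ] (g ∘ suc))) ⟩
  g 0 + 0ℚ                                      ≡⟨ +-identityʳ (g 0) ⟩
  g 0                                           ∎
∑-δ (suc n) (suc m) g zero′ = begin
  0ℚ * g 0 + ∑[0≤i≤ n ] (λ s → δ m s * g (suc s)) ≡⟨ cong₂ _+_ (*-zeroˡ (g 0)) (∑-δ n m (g ∘ suc) (zero′ ∘ s≤s)) ⟩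
  0ℚ + g (suc m)                                  ≡⟨ +-identityˡ (g (suc m)) ⟩
  g (suc m)                                       ∎

binomial-suc : ∀ α k (g : ℕ → ℚ) →
  ∑[0≤i≤ suc k ] (λ j → fromℕ (suc k C j) * α ^ (suc k ∸ j) * g j)
  ≡ α * ∑[0≤i≤ k ] (λ j → fromℕ (k C j) * α ^ (k ∸ j) * g j)
    + ∑[0≤i≤ k ] (λ j → fromℕ (k C j) * α ^ (k ∸ j) * g (suc j))
binomial-suc α k g = begin
  fromℕ (suc k C 0) * α ^ suc k * g 0 + ∑[0≤i≤ k ] (λ j → fromℕ (suc k C suc j) * α ^ (k ∸ j) * g (suc j))
    ≡⟨ cong (fromℕ 1 * α ^ suc k * g 0 +_) (trans (∑-cong k λ j _ → pascal j) (∑-+ k (t ∘ suc) u)) ⟩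
  t 0 + (∑[0≤i≤ k ] (t ∘ suc) + ∑[0≤i≤ k ] u)   ≡⟨ +-assoc (t 0) (∑[0≤i≤ k ] (t ∘ suc)) (∑[0≤i≤ k ] u) ⟨
  ∑[0≤i≤ suc k ] t + ∑[0≤i≤ k ] u               ≡⟨ cong (_+ ∑[0≤i≤ k ] u) (∑-last k t) ⟩
  ∑[0≤i≤ k ] t + t (suc k) + ∑[0≤i≤ k ] u       ≡⟨ cong (λ z → ∑[0≤i≤ k ] t + z + ∑[0≤i≤ k ] u) t-last ⟩
  ∑[0≤i≤ k ] t + 0ℚ + ∑[0≤i≤ k ] u              ≡⟨ cong (_+ ∑[0≤i≤ k ] u) (trans (+-identityʳ (∑[0≤i≤ k ] t))
                                                     (trans (∑-cong k factor) (∑-*ˡ k α v))) ⟩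
  α * ∑[0≤i≤ k ] (λ j → fromℕ (k C j) * α ^ (k ∸ j) * g j) + ∑[0≤i≤ k ] u ∎
  where
  open +-*-Solver
  t u v : ℕ → ℚ
  v j = fromℕ (k C j) * α ^ (k ∸ j) * g j
  t j = fromℕ (k C j) * α ^ (suc k ∸ j) * g j
  u j = fromℕ (k C j) * α ^ (k ∸ j) * g (suc j)

  pascal : ∀ j → fromℕ (suc k C suc j) * α ^ (k ∸ j) * g (suc j) ≡ t (suc j) + u j
  pascal j = begin
    fromℕ (suc k C suc j) * α ^ (k ∸ j) * g (suc j)
      ≡⟨ cong (λ c → fromℕ c * α ^ (k ∸ j) * g (suc j)) (nCk+nC[k+1]≡[n+1]C[k+1] k j) ⟨
    fromℕ (k C j ℕ.+ k C suc j) * α ^ (k ∸ j) * g (suc j)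
      ≡⟨ cong (λ c → c * α ^ (k ∸ j) * g (suc j)) (fromℕ-+ (k C j) (k C suc j)) ⟩
    (fromℕ (k C j) + fromℕ (k C suc j)) * α ^ (k ∸ j) * g (suc j)
      ≡⟨ solve 4 (λ a b c d → (a :+ b) :* c :* d := b :* c :* d :+ a :* c :* d) refl
           (fromℕ (k C j)) (fromℕ (k C suc j)) (α ^ (k ∸ j)) (g (suc j)) ⟩
    t (suc j) + u j ∎

  t-last : t (suc k) ≡ 0ℚ
  t-last = begin
    fromℕ (k C suc k) * α ^ (k ∸ k) * g (suc k) ≡⟨ cong (λ c → fromℕ c * α ^ (k ∸ k) * g (suc k)) (k>n⇒nCk≡0 (ℕ.n<1+n k)) ⟩
    0ℚ * α ^ (k ∸ k) * g (suc k)                ≡⟨ cong (_* g (suc k)) (*-zeroˡ (α ^ (k ∸ k))) ⟩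
    0ℚ * g (suc k)                              ≡⟨ *-zeroˡ (g (suc k)) ⟩
    0ℚ                                          ∎

  factor : ∀ j → j ℕ.≤ k → t j ≡ α * (fromℕ (k C j) * α ^ (k ∸ j) * g j)
  factor j j≤k = begin
    fromℕ (k C j) * α ^ (suc k ∸ j) * g j       ≡⟨ cong (λ e → fromℕ (k C j) * α ^ e * g j) (ℕ.+-∸-assoc 1 j≤k) ⟩
    fromℕ (k C j) * (α * α ^ (k ∸ j)) * g j     ≡⟨ solve 4 (λ c a p g → c :* (a :* p) :* g := a :* (c :* p :* g)) refl
                                                     (fromℕ (k C j)) α (α ^ (k ∸ j)) (g j) ⟩
    α * (fromℕ (k C j) * α ^ (k ∸ j) * g j)     ∎

-- The hypothesis says that raising `k` applies α + S, where S shifts `s`, so `f k` is (α + S)^k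
-- applied to `f 0`. The value α = 1 serves (1 + x∇)^k, and α = -1 serves ∇^s.
binomial : ∀ α (f : ℕ → ℕ → ℚ) → (∀ k s → f (suc k) s ≡ α * f k s + f k (suc s)) →
           ∀ k s → f k s ≡ ∑[0≤i≤ k ] (λ j → fromℕ (k C j) * α ^ (k ∸ j) * f 0 (j ℕ.+ s))
binomial α f rec zero    s = solve 1 (λ a → a := con 1ℚ :* con 1ℚ :* a :+ con 0ℚ) refl (f 0 s)
  where open +-*-Solver
binomial α f rec (suc k) s = begin
  f (suc k) s
    ≡⟨ rec k s ⟩
  α * f k s + f k (suc s)
    ≡⟨ cong₂ (λ p q → α * p + q) (binomial α f rec k s) (trans (binomial α f rec k (suc s))
         (∑-cong k λ j _ → cong (λ i → fromℕ (k C j) * α ^ (k ∸ j) * f 0 i) (ℕ.+-suc j s))) ⟩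
  α * ∑[0≤i≤ k ] (λ j → fromℕ (k C j) * α ^ (k ∸ j) * f 0 (j ℕ.+ s))
    + ∑[0≤i≤ k ] (λ j → fromℕ (k C j) * α ^ (k ∸ j) * f 0 (suc j ℕ.+ s))
    ≡⟨ binomial-suc α k (λ j → f 0 (j ℕ.+ s)) ⟨
  ∑[0≤i≤ suc k ] (λ j → fromℕ (suc k C j) * α ^ (suc k ∸ j) * f 0 (j ℕ.+ s)) ∎

-- Powers of the difference operator.

keep-or-move : ∀ f g m → (1-X ⊛ f ⊕ X ⊛ g) (suc m) ≡ f (suc m) + (g m - f m)
keep-or-move f g m = begin
  (1-X ⊛ f) (suc m) + (X ⊛ g) (suc m)
    ≡⟨ cong₂ _+_ (⊛-distribʳ f (const 1ℚ) (𝕊.- X) (suc m)) (X-⊛ g (suc m)) ⟩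
  (const 1ℚ ⊛ f) (suc m) + ((𝕊.- X) ⊛ f) (suc m) + g m
    ≡⟨ cong₂ (λ p q → p + q + g m) (⊛-identityˡ f (suc m))
         (trans (sym (-‿distribˡ-* X f (suc m))) (cong -_ (X-⊛ f (suc m)))) ⟩
  f (suc m) + - f m + g m
    ≡⟨ solve 3 (λ a b c → a :+ :- b :+ c := a :+ (c :- b)) refl (f (suc m)) (f m) (g m) ⟩
  f (suc m) + (g m - f m) ∎
  where
  open +-*-Solver
  open Algebra.Properties.Ring 𝕊.ring using (-‿distribˡ-*)

keep-or-move₀ : ∀ f g → (1-X ⊛ f ⊕ X ⊛ g) 0 ≡ f 0
keep-or-move₀ f g = solve 2 (λ a b → (con 1ℚ :+ :- con 0ℚ) :* a :+ con 0ℚ :* b := a) refl (f 0) (g 0)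
  where open +-*-Solver

-- (x∇)^s applied to freeWeight 0 r.
shiftedΔ : ℕ → ℕ → ℕ → Series
shiftedΔ r zero    h m       = freeWeight 0 r h m
shiftedΔ r (suc s) h zero    = 0ℚ
shiftedΔ r (suc s) h (suc m) = shiftedΔ r s (suc h) m - shiftedΔ r s h m

-- (1 + x∇)^k (x∇)^s applied to freeWeight 0 r.
mixedΔ : ℕ → ℕ → ℕ → ℕ → Series
mixedΔ r zero    s h = shiftedΔ r s h
mixedΔ r (suc k) s h = mixedΔ r k s h ⊕ mixedΔ r k (suc s) h

mixedΔ-zero : ∀ r k s h → mixedΔ r k (suc s) h 0 ≡ 0ℚ
mixedΔ-zero r zero    s h = refl
mixedΔ-zero r (suc k) s h = cong₂ _+_ (mixedΔ-zero r k s h) (mixedΔ-zero r k (suc s) h)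

-- x∇ commutes with 1 + x∇, so a factor x∇ that the definition applies innermost can be pulled out
-- to the front.
mixedΔ-suc : ∀ r k s h m → mixedΔ r k (suc s) h (suc m) ≡ mixedΔ r k s (suc h) m - mixedΔ r k s h m
mixedΔ-suc r zero    s h m = refl
mixedΔ-suc r (suc k) s h m = trans (cong₂ _+_ (mixedΔ-suc r k s h m) (mixedΔ-suc r k (suc s) h m))
  (solve 4 (λ a b c d → a :- b :+ (c :- d) := a :+ c :- (b :+ d)) refl
    (mixedΔ r k s (suc h) m) (mixedΔ r k s h m) (mixedΔ r k (suc s) (suc h) m) (mixedΔ r k (suc s) h m))
  where open +-*-Solver

freeWeight-mixedΔ : ∀ k r h m → freeWeight k r h m ≡ mixedΔ r k 0 h m
freeWeight-mixedΔ zero    r h m       = refl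
freeWeight-mixedΔ (suc k) r h zero    = begin
  (1-X ⊛ freeWeight k r h ⊕ X ⊛ freeWeight k r (suc h)) 0   ≡⟨ keep-or-move₀ (freeWeight k r h) (freeWeight k r (suc h)) ⟩
  freeWeight k r h 0                               ≡⟨ freeWeight-mixedΔ k r h 0 ⟩
  mixedΔ r k 0 h 0                             ≡⟨ +-identityʳ (mixedΔ r k 0 h 0) ⟨
  mixedΔ r k 0 h 0 + 0ℚ                        ≡⟨ cong (mixedΔ r k 0 h 0 +_) (mixedΔ-zero r k 0 h) ⟨
  mixedΔ r k 0 h 0 + mixedΔ r k 1 h 0               ∎
freeWeight-mixedΔ (suc k) r h (suc m) = begin
  (1-X ⊛ freeWeight k r h ⊕ X ⊛ freeWeight k r (suc h)) (suc m)       ≡⟨ keep-or-move (freeWeight k r h) (freeWeight k r (suc h)) m ⟩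
  freeWeight k r h (suc m) + (freeWeight k r (suc h) m - freeWeight k r h m)   ≡⟨ cong₂ _+_ (freeWeight-mixedΔ k r h (suc m))
                                                         (cong₂ _-_ (freeWeight-mixedΔ k r (suc h) m) (freeWeight-mixedΔ k r h m)) ⟩
  mixedΔ r k 0 h (suc m) + (mixedΔ r k 0 (suc h) m - mixedΔ r k 0 h m)   ≡⟨ cong (mixedΔ r k 0 h (suc m) +_) (mixedΔ-suc r k 0 h m) ⟨
  mixedΔ r k 0 h (suc m) + mixedΔ r k 1 h (suc m)             ∎

-- ∇^s applied to the coefficient of x^j in freeWeight 0 r.
Δ : ℕ → ℕ → ℕ → ℕ → ℚ
Δ r j zero    h = freeWeight 0 r h j
-- Written with `- 1ℚ *` so that the hypothesis of `binomial` holds by `refl`.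
Δ r j (suc s) h = - 1ℚ * Δ r j s h + Δ r j s (suc h)

-- (x∇)^s carries the factor x^s.
shiftedΔ-< : ∀ r {m s} h → m ℕ.< s → shiftedΔ r s h m ≡ 0ℚ
shiftedΔ-< r {zero}  {suc s} h _         = refl
shiftedΔ-< r {suc m} {suc s} h (s≤s m<s) = cong₂ _-_ (shiftedΔ-< r (suc h) m<s) (shiftedΔ-< r h m<s)

shiftedΔ-≥ : ∀ r s h j → shiftedΔ r s h (s ℕ.+ j) ≡ Δ r j s h
shiftedΔ-≥ r zero    h j = refl
shiftedΔ-≥ r (suc s) h j = trans (cong₂ _-_ (shiftedΔ-≥ r s (suc h) j) (shiftedΔ-≥ r s h j))
  (solve 2 (λ a b → a :- b := :- con 1ℚ :* b :+ a) refl (Δ r j s (suc h)) (Δ r j s h))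
  where open +-*-Solver

1^ : ∀ n → 1ℚ ^ n ≡ 1ℚ
1^ zero    = refl
1^ (suc n) = trans (*-identityˡ (1ℚ ^ n)) (1^ n)

freeWeight-∑ : ∀ k r m → freeWeight k r 0 m ≡ ∑[0≤i≤ k ] (λ s → fromℕ (k C s) * shiftedΔ r s 0 m)
freeWeight-∑ k r m = begin
  freeWeight k r 0 m   ≡⟨ freeWeight-mixedΔ k r 0 m ⟩
  mixedΔ r k 0 0 m ≡⟨ binomial 1ℚ (λ k s → mixedΔ r k s 0 m)
                   (λ k s → cong (_+ mixedΔ r k (suc s) 0 m) (sym (*-identityˡ (mixedΔ r k s 0 m)))) k 0 ⟩
  ∑[0≤i≤ k ] (λ s → fromℕ (k C s) * 1ℚ ^ (k ∸ s) * shiftedΔ r (s ℕ.+ 0) 0 m)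
    ≡⟨ ∑-cong k (λ s _ → cong₂ _*_ (trans (cong (fromℕ (k C s) *_) (1^ (k ∸ s))) (*-identityʳ (fromℕ (k C s))))
                                   (cong (λ s → shiftedΔ r s 0 m) (ℕ.+-identityʳ s))) ⟩
  ∑[0≤i≤ k ] (λ s → fromℕ (k C s) * shiftedΔ r s 0 m) ∎

stirling₁-one : ∀ r → stirling₁ (suc r) (ℤ.+ 1) ≡ r !
stirling₁-one zero    = refl
stirling₁-one (suc r) = trans (stirling₁-suc (suc r) 0)
  (cong₂ (λ a b → a ℕ.+ suc r ℕ.* b) (stirling₁-zero r) (stirling₁-one r))

δ-self : ∀ s → δ (s ℕ.+ 0) s ≡ 1ℚ
δ-self zero    = refl
δ-self (suc s) = δ-self s

δ-> : ∀ s j → δ (s ℕ.+ suc j) s ≡ 0ℚ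
δ-> zero    j = refl
δ-> (suc s) j = δ-> s j

δ-< : ∀ {m s} → m ℕ.< s → δ m s ≡ 0ℚ
δ-< {zero}  {suc s} _         = refl
δ-< {suc m} {suc s} (s≤s m<s) = δ-< m<s

-- Evaluation at h = 0 and the closed form.

1/_! : ℕ → ℚ
1/ n ! = (ℤ.+ 1 / n !) {{n ℕ.!≢0}}

C*! : ∀ {s ℓ} → ℓ ℕ.≤ s → (s C ℓ) ℕ.* (ℓ ! ℕ.* (s ∸ ℓ) !) ≡ s !
C*! {s} {ℓ} ℓ≤s = trans (cong (ℕ._* (ℓ ! ℕ.* (s ∸ ℓ) !)) (nCk≡n!/k![n-k]! ℓ≤s))
  (ℕ.m/n*n≡m {{ℓ ℕ.!* (s ∸ ℓ) !≢0}} (k![n∸k]!∣n! ℓ≤s))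

-- `ℓ !` is the factorial in φ ℓ; it turns the binomial coefficient of ∇^s into the s!/(s-ℓ)! of the
-- theorem.
C*!-ℚ : ∀ {s ℓ} → ℓ ℕ.≤ s → fromℕ (s C ℓ) * fromℕ (ℓ !) ≡ fromℕ (s !) * 1/ (s ∸ ℓ) !
C*!-ℚ {s} {ℓ} ℓ≤s = begin
  c * fromℕ (ℓ !)                       ≡⟨ *-identityʳ (c * fromℕ (ℓ !)) ⟨
  c * fromℕ (ℓ !) * 1ℚ                  ≡⟨ cong (c * fromℕ (ℓ !) *_) (1/n*n (t !) {{t ℕ.!≢0}}) ⟨
  c * fromℕ (ℓ !) * (1/ t ! * fromℕ (t !))
    ≡⟨ solve 4 (λ a b c d → a :* b :* (c :* d) := a :* (b :* d) :* c) refl c (fromℕ (ℓ !)) (1/ t !) (fromℕ (t !)) ⟩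
  c * (fromℕ (ℓ !) * fromℕ (t !)) * 1/ t !
    ≡⟨ cong (_* 1/ t !) (trans (fromℕ-* (s C ℓ) (ℓ ! ℕ.* t !)) (cong (c *_) (fromℕ-* (ℓ !) (t !)))) ⟨
  fromℕ ((s C ℓ) ℕ.* (ℓ ! ℕ.* t !)) * 1/ t !
    ≡⟨ cong (λ z → fromℕ z * 1/ t !) (C*! ℓ≤s) ⟩
  fromℕ (s !) * 1/ t ! ∎
  where
  open +-*-Solver
  t = s ∸ ℓ
  c = fromℕ (s C ℓ)

innerSum : ℕ → ℤ.ℤ → ℚ
innerSum s e = ∑[1≤i≤ s ] λ ℓ → ((- 1ℚ) ^ (s ∸ ℓ) * ℓ ^ᶻ e) /! (s ∸ ℓ)

+-[m+n]+m : ∀ s j → ℤ.+ (s ℕ.+ j) ℤ.- ℤ.+ s ≡ ℤ.+ j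
+-[m+n]+m s j = begin
  ℤ.+ (s ℕ.+ j) ℤ.- ℤ.+ s ≡⟨ ℤ.m-n≡m⊖n (s ℕ.+ j) s ⟩
  (s ℕ.+ j) ℤ.⊖ s         ≡⟨ ℤ.⊖-≥ (ℕ.m≤m+n s j) ⟩
  ℤ.+ (s ℕ.+ j ∸ s)       ≡⟨ cong ℤ.+_ (ℕ.m+n∸m≡n s j) ⟩
  ℤ.+ j                   ∎

-- The term of index 0 stands apart: φ 0 = r! has no higher coefficients, so it contributes for j =
-- 0 only, which `δ` encodes.
Δ-formula : ∀ r s j → Δ r j s 0 ≡
  δ (s ℕ.+ j) s * ((- 1ℚ) ^ s * fromℕ (r !)) + fromℕ (stirling₁ (suc r) (ℤ.+ suc j)) * (fromℕ (s !) * innerSum s (ℤ.+ j))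
Δ-formula r s j = begin
  Δ r j s 0
    ≡⟨ binomial (- 1ℚ) (Δ r j) (λ _ _ → refl) s 0 ⟩
  ∑[0≤i≤ s ] (λ ℓ → fromℕ (s C ℓ) * (- 1ℚ) ^ (s ∸ ℓ) * freeWeight 0 r (ℓ ℕ.+ 0) j)
    ≡⟨ cong₂ _+_ (first j) (trans (∑₁-cong s {λ ℓ → fromℕ (s C ℓ) * (- 1ℚ) ^ (s ∸ ℓ) * freeWeight 0 r (ℓ ℕ.+ 0) j}
                                     {λ ℓ → fromℕ c * (fromℕ (s !) * t ℓ)} (λ i → rest (suc i)))
         (trans (∑₁-*ˡ s (fromℕ c) (λ ℓ → fromℕ (s !) * t ℓ)) (cong (fromℕ c *_) (∑₁-*ˡ s (fromℕ (s !)) t)))) ⟩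
  δ (s ℕ.+ j) s * ((- 1ℚ) ^ s * fromℕ (r !)) + fromℕ c * (fromℕ (s !) * innerSum s (ℤ.+ j)) ∎
  where
  open +-*-Solver
  c = stirling₁ (suc r) (ℤ.+ suc j)
  t : ∀ ℓ → .{{NonZero ℓ}} → ℚ
  t ℓ = ((- 1ℚ) ^ (s ∸ ℓ) * ℓ ^ᶻ (ℤ.+ j)) /! (s ∸ ℓ)

  first : ∀ j → fromℕ (s C 0) * (- 1ℚ) ^ s * freeWeight 0 r 0 j ≡ δ (s ℕ.+ j) s * ((- 1ℚ) ^ s * fromℕ (r !))
  first zero = begin
    fromℕ 1 * (- 1ℚ) ^ s * freeWeight 0 r 0 0
      ≡⟨ cong (fromℕ 1 * (- 1ℚ) ^ s *_) (trans (freeWeight-attentive r 0 0) (cong fromℕ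
           (trans (ℕ.*-identityˡ (stirling₁ (suc r) (ℤ.+ 1) ℕ.* 1))
             (trans (ℕ.*-identityʳ (stirling₁ (suc r) (ℤ.+ 1))) (stirling₁-one r))))) ⟩
    fromℕ 1 * (- 1ℚ) ^ s * fromℕ (r !)
      ≡⟨ *-assoc (fromℕ 1) ((- 1ℚ) ^ s) (fromℕ (r !)) ⟩
    1ℚ * ((- 1ℚ) ^ s * fromℕ (r !))
      ≡⟨ cong (_* ((- 1ℚ) ^ s * fromℕ (r !))) (δ-self s) ⟨
    δ (s ℕ.+ 0) s * ((- 1ℚ) ^ s * fromℕ (r !)) ∎
  first (suc j) = begin
    fromℕ 1 * (- 1ℚ) ^ s * freeWeight 0 r 0 (suc j)
      ≡⟨ cong (fromℕ 1 * (- 1ℚ) ^ s *_) (trans (freeWeight-attentive r 0 (suc j)) (cong fromℕ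
           (cong (1 ℕ.*_) (ℕ.*-zeroʳ (stirling₁ (suc r) (ℤ.+ suc (suc j))))))) ⟩
    fromℕ 1 * (- 1ℚ) ^ s * 0ℚ
      ≡⟨ *-zeroʳ (fromℕ 1 * (- 1ℚ) ^ s) ⟩
    0ℚ
      ≡⟨ *-zeroˡ ((- 1ℚ) ^ s * fromℕ (r !)) ⟨
    0ℚ * ((- 1ℚ) ^ s * fromℕ (r !))
      ≡⟨ cong (_* ((- 1ℚ) ^ s * fromℕ (r !))) (δ-> s j) ⟨
    δ (s ℕ.+ suc j) s * ((- 1ℚ) ^ s * fromℕ (r !)) ∎

  rest : ∀ ℓ .{{_ : NonZero ℓ}} → ℓ ℕ.≤ s →
         fromℕ (s C ℓ) * (- 1ℚ) ^ (s ∸ ℓ) * freeWeight 0 r (ℓ ℕ.+ 0) j ≡ fromℕ c * (fromℕ (s !) * t ℓ)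
  rest ℓ ℓ≤s = begin
    fromℕ (s C ℓ) * (- 1ℚ) ^ (s ∸ ℓ) * freeWeight 0 r (ℓ ℕ.+ 0) j
      ≡⟨ cong (fromℕ (s C ℓ) * (- 1ℚ) ^ (s ∸ ℓ) *_)
           (trans (cong (λ h → freeWeight 0 r h j) (ℕ.+-identityʳ ℓ)) (trans (freeWeight-attentive r ℓ j)
             (trans (fromℕ-* (ℓ !) (c ℕ.* ℓ ℕ.^ j)) (cong (fromℕ (ℓ !) *_) (fromℕ-* c (ℓ ℕ.^ j)))))) ⟩
    fromℕ (s C ℓ) * (- 1ℚ) ^ (s ∸ ℓ) * (fromℕ (ℓ !) * (fromℕ c * fromℕ (ℓ ℕ.^ j)))
      ≡⟨ solve 5 (λ a b d e f → a :* b :* (d :* (e :* f)) := a :* d :* (e :* (b :* f))) refl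
           (fromℕ (s C ℓ)) ((- 1ℚ) ^ (s ∸ ℓ)) (fromℕ (ℓ !)) (fromℕ c) (fromℕ (ℓ ℕ.^ j)) ⟩
    fromℕ (s C ℓ) * fromℕ (ℓ !) * (fromℕ c * ((- 1ℚ) ^ (s ∸ ℓ) * fromℕ (ℓ ℕ.^ j)))
      ≡⟨ cong (_* (fromℕ c * ((- 1ℚ) ^ (s ∸ ℓ) * fromℕ (ℓ ℕ.^ j)))) (C*!-ℚ ℓ≤s) ⟩
    fromℕ (s !) * 1/ (s ∸ ℓ) ! * (fromℕ c * ((- 1ℚ) ^ (s ∸ ℓ) * fromℕ (ℓ ℕ.^ j)))
      ≡⟨ solve 4 (λ a b c d → a :* b :* (c :* d) := c :* (a :* (d :* b))) refl
           (fromℕ (s !)) (1/ (s ∸ ℓ) !) (fromℕ c) ((- 1ℚ) ^ (s ∸ ℓ) * fromℕ (ℓ ℕ.^ j)) ⟩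
    fromℕ c * (fromℕ (s !) * t ℓ) ∎

stirling₁-neg : ∀ i p → stirling₁ i ℤ.-[1+ p ] ≡ 0
stirling₁-neg i p = cong length (filter-none (λ σ → ℤ.+ numCycles σ ℤ.≟ ℤ.-[1+ p ])
  {permutations i} (All.universal (λ _ ()) (permutations i)))

-- The lower index is 0 for s = m + 1 and negative beyond, and a permutation of a nonempty set has
-- at least one cycle.
stirling₁-< : ∀ r {m s} → m ℕ.< s → stirling₁ (suc r) (ℤ.+ m ℤ.- ℤ.+ s ℤ.+ ℤ.+ 1) ≡ 0
stirling₁-< r {m} {s} m<s with ℕ.m≤n⇒∃[o]m+o≡n m<s
... | p , refl = trans (cong (λ z → stirling₁ (suc r) (z ℤ.+ ℤ.+ 1)) difference) (vanish p)
  where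
  difference : ℤ.+ m ℤ.- ℤ.+ suc (m ℕ.+ p) ≡ ℤ.-[1+ p ]
  difference = begin
    ℤ.+ m ℤ.- ℤ.+ suc (m ℕ.+ p)       ≡⟨ ℤ.m-n≡m⊖n m (suc (m ℕ.+ p)) ⟩
    m ℤ.⊖ suc (m ℕ.+ p)               ≡⟨ cong₂ ℤ._⊖_ (ℕ.+-identityʳ m) (ℕ.+-suc m p) ⟨
    (m ℕ.+ 0) ℤ.⊖ (m ℕ.+ suc p)       ≡⟨ ℤ.+-cancelˡ-⊖ m 0 (suc p) ⟩
    ℤ.-[1+ p ]                        ∎
  vanish : ∀ p → stirling₁ (suc r) (ℤ.-[1+ p ] ℤ.+ ℤ.+ 1) ≡ 0
  vanish zero    = stirling₁-zero r
  vanish (suc p) = stirling₁-neg (suc r) p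

-- The sign is (-1)^m and not (-1)^s, which `δ m s` makes equivalent; it can then leave the sum over
-- `s`.
ShiftedΔFormula : ℕ → ℕ → ℕ → Set
ShiftedΔFormula r m s = shiftedΔ r s 0 m ≡
  δ m s * ((- 1ℚ) ^ m * fromℕ (r !))
    + fromℕ (stirling₁ (suc r) (ℤ.+ m ℤ.- ℤ.+ s ℤ.+ ℤ.+ 1)) * (fromℕ (s !) * innerSum s (ℤ.+ m ℤ.- ℤ.+ s))

-- The Stirling number vanishes, so the negative powers inside `innerSum` need no evaluation.
shiftedΔ-formula-< : ∀ r {m s} → m ℕ.< s → ShiftedΔFormula r m s
shiftedΔ-formula-< r {m} {s} m<s = begin
  shiftedΔ r s 0 m
    ≡⟨ shiftedΔ-< r 0 m<s ⟩
  0ℚ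
    ≡⟨ solve 2 (λ a b → con 0ℚ := con 0ℚ :* a :+ con 0ℚ :* b) refl
         ((- 1ℚ) ^ m * fromℕ (r !)) (fromℕ (s !) * innerSum s (ℤ.+ m ℤ.- ℤ.+ s)) ⟩
  0ℚ * ((- 1ℚ) ^ m * fromℕ (r !)) + 0ℚ * (fromℕ (s !) * innerSum s (ℤ.+ m ℤ.- ℤ.+ s))
    ≡⟨ cong₂ (λ d c → d * ((- 1ℚ) ^ m * fromℕ (r !)) + fromℕ c * (fromℕ (s !) * innerSum s (ℤ.+ m ℤ.- ℤ.+ s)))
         (δ-< m<s) (stirling₁-< r m<s) ⟨
  δ m s * ((- 1ℚ) ^ m * fromℕ (r !))
    + fromℕ (stirling₁ (suc r) (ℤ.+ m ℤ.- ℤ.+ s ℤ.+ ℤ.+ 1)) * (fromℕ (s !) * innerSum s (ℤ.+ m ℤ.- ℤ.+ s)) ∎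
  where open +-*-Solver

shiftedΔ-formula-≥ : ∀ r s j → ShiftedΔFormula r (s ℕ.+ j) s
shiftedΔ-formula-≥ r s j = begin
  shiftedΔ r s 0 (s ℕ.+ j)
    ≡⟨ trans (shiftedΔ-≥ r s 0 j) (Δ-formula r s j) ⟩
  δ (s ℕ.+ j) s * ((- 1ℚ) ^ s * fromℕ (r !)) + tail (ℤ.+ suc j) (ℤ.+ j)
    ≡⟨ cong₂ _+_ (sign j) (cong₂ tail
         (trans (cong ℤ.+_ (ℕ.+-comm 1 j)) (cong (ℤ._+ ℤ.+ 1) (sym (+-[m+n]+m s j)))) (sym (+-[m+n]+m s j))) ⟩
  δ (s ℕ.+ j) s * ((- 1ℚ) ^ (s ℕ.+ j) * fromℕ (r !))
    + tail (ℤ.+ (s ℕ.+ j) ℤ.- ℤ.+ s ℤ.+ ℤ.+ 1) (ℤ.+ (s ℕ.+ j) ℤ.- ℤ.+ s) ∎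
  where
  tail : ℤ.ℤ → ℤ.ℤ → ℚ
  tail a b = fromℕ (stirling₁ (suc r) a) * (fromℕ (s !) * innerSum s b)

  sign : ∀ j → δ (s ℕ.+ j) s * ((- 1ℚ) ^ s * fromℕ (r !)) ≡ δ (s ℕ.+ j) s * ((- 1ℚ) ^ (s ℕ.+ j) * fromℕ (r !))
  sign zero    = cong (λ e → δ (s ℕ.+ 0) s * ((- 1ℚ) ^ e * fromℕ (r !))) (sym (ℕ.+-identityʳ s))
  sign (suc j) = begin
    δ (s ℕ.+ suc j) s * ((- 1ℚ) ^ s * fromℕ (r !))             ≡⟨ cong (_* ((- 1ℚ) ^ s * fromℕ (r !))) (δ-> s j) ⟩
    0ℚ * ((- 1ℚ) ^ s * fromℕ (r !))                            ≡⟨ *-zeroˡ ((- 1ℚ) ^ s * fromℕ (r !)) ⟩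
    0ℚ                                                         ≡⟨ *-zeroˡ ((- 1ℚ) ^ (s ℕ.+ suc j) * fromℕ (r !)) ⟨
    0ℚ * ((- 1ℚ) ^ (s ℕ.+ suc j) * fromℕ (r !))                ≡⟨ cong (_* ((- 1ℚ) ^ (s ℕ.+ suc j) * fromℕ (r !))) (δ-> s j) ⟨
    δ (s ℕ.+ suc j) s * ((- 1ℚ) ^ (s ℕ.+ suc j) * fromℕ (r !)) ∎

shiftedΔ-formula : ∀ r m s → ShiftedΔFormula r m s
shiftedΔ-formula r m s = [ shiftedΔ-formula-< r
                  , (λ s≤m → subst (λ m → ShiftedΔFormula r m s) (ℕ.m+[n∸m]≡n s≤m) (shiftedΔ-formula-≥ r s (m ∸ s))) ]′
                  (ℕ.<-≤-connex m s)

freeWeight-closed : ∀ k r m → freeWeight k r 0 m ≡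
  (- 1ℚ) ^ m * fromℕ (r !) * fromℕ (k C m)
    + ∑[1≤i≤ k ] λ s → fromℕ (stirling₁ (suc r) (ℤ.+ m ℤ.- ℤ.+ s ℤ.+ ℤ.+ 1)) * fromℕ (k C s) * fromℕ (s !)
                       * innerSum s (ℤ.+ m ℤ.- ℤ.+ s)
freeWeight-closed k r m = begin
  freeWeight k r 0 m
    ≡⟨ freeWeight-∑ k r m ⟩
  ∑[0≤i≤ k ] (λ s → fromℕ (k C s) * shiftedΔ r s 0 m)
    ≡⟨ ∑-cong k {λ s → fromℕ (k C s) * shiftedΔ r s 0 m} {λ s → δ m s * (e * fromℕ (k C s)) + b s} (λ s _ → split s) ⟩
  ∑[0≤i≤ k ] (λ s → δ m s * (e * fromℕ (k C s)) + b s)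
    ≡⟨ ∑-+ k (λ s → δ m s * (e * fromℕ (k C s))) b ⟩
  ∑[0≤i≤ k ] (λ s → δ m s * (e * fromℕ (k C s))) + ∑[0≤i≤ k ] b
    ≡⟨ cong₂ _+_ (∑-δ k m (λ s → e * fromℕ (k C s)) λ k<m →
                    trans (cong (λ c → e * fromℕ c) (k>n⇒nCk≡0 k<m)) (*-zeroʳ e))
                 (trans (cong (_+ ∑[1≤i≤ k ] λ s → b s) b₀) (+-identityˡ (∑[1≤i≤ k ] λ s → b s))) ⟩
  e * fromℕ (k C m) + ∑[1≤i≤ k ] (λ s → b s) ∎
  where
  open +-*-Solver
  e : ℚ
  e = (- 1ℚ) ^ m * fromℕ (r !)
  c b : ℕ → ℚ
  c s = fromℕ (stirling₁ (suc r) (ℤ.+ m ℤ.- ℤ.+ s ℤ.+ ℤ.+ 1))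
  b s = c s * fromℕ (k C s) * fromℕ (s !) * innerSum s (ℤ.+ m ℤ.- ℤ.+ s)
  -- For s = 0 the inner sum is empty, so the outer sum may start at 1.
  b₀ : b 0 ≡ 0ℚ
  b₀ = *-zeroʳ (c 0 * fromℕ (k C 0) * fromℕ (0 !))
  split : ∀ s → fromℕ (k C s) * shiftedΔ r s 0 m ≡ δ m s * (e * fromℕ (k C s)) + b s
  split s = trans (cong (fromℕ (k C s) *_) (shiftedΔ-formula r m s))
    (solve 6 (λ x d e c f i → x :* (d :* e :+ c :* (f :* i)) := d :* (e :* x) :+ c :* x :* f :* i) refl
      (fromℕ (k C s)) (δ m s) e (c s) (fromℕ (s !)) (innerSum s (ℤ.+ m ℤ.- ℤ.+ s)))

-- `n` and `a` are tied to `k` and `r` by equations because `k + (n ∸ k)` is `n`, and `n ∸ k +ⁿ 1`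
-- is `suc (n ∸ k)`, only up to a proof.
P-closed : ∀ {n a} k r m → k ℕ.+ r ≡ n → suc r ≡ a → P n k m ≡
  ((- 1ℚ) ^ m * fromℕ (r !)) /! n * fromℕ (k C m)
    + (∑[1≤i≤ k ] λ s → fromℕ (stirling₁ a (ℤ.+ m ℤ.- ℤ.+ s ℤ.+ ℤ.+ 1)) * fromℕ (k C s) * fromℕ (s !)
                        * innerSum s (ℤ.+ m ℤ.- ℤ.+ s)) /! n
P-closed {n} k r m refl refl = begin
  P n k m                               ≡⟨ *-identityˡ (P n k m) ⟨
  1ℚ * P n k m                          ≡⟨ cong (_* P n k m) (1/n*n (n !) {{n ℕ.!≢0}}) ⟨
  1/ n ! * fromℕ (n !) * P n k m        ≡⟨ *-assoc (1/ n !) (fromℕ (n !)) (P n k m) ⟩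
  1/ n ! * (fromℕ (n !) * P n k m)      ≡⟨ cong (1/ n ! *_) (trans (P-freeWeight k r m) (freeWeight-closed k r m)) ⟩
  1/ n ! * (e * fromℕ (k C m) + b)      ≡⟨ solve 4 (λ i e c b → i :* (e :* c :+ b) := e :* i :* c :+ b :* i) refl
                                             (1/ n !) e (fromℕ (k C m)) b ⟩
  e /! n * fromℕ (k C m) + b /! n       ∎
  where
  open +-*-Solver
  e b : ℚ
  e = (- 1ℚ) ^ m * fromℕ (r !)
  b = ∑[1≤i≤ k ] λ s → fromℕ (stirling₁ (suc r) (ℤ.+ m ℤ.- ℤ.+ s ℤ.+ ℤ.+ 1)) * fromℕ (k C s) * fromℕ (s !)
                       * innerSum s (ℤ.+ m ℤ.- ℤ.+ s)

open import Data.Nat.Base using (_≤_) renaming (_+_ to _+ⁿ_)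
open import Data.Integer.Base using (+_) renaming (_+_ to _+ᶻ_; _-_ to _-ᶻ_)

theorem1 : (n k m : ℕ) → 1 ≤ n → 1 ≤ k → k ≤ n →
    P n k m ≡
    ((- 1ℚ) ^ m * fromℕ ((n ∸ k) !)) /! n * fromℕ (k C m)
    + (∑[1≤i≤ k ] λ s →
    fromℕ (stirling₁ (n ∸ k +ⁿ 1) (+ m -ᶻ + s +ᶻ + 1))
    * fromℕ (k C s) * fromℕ (s !)
    * (∑[1≤i≤ s ] λ ℓ →
    ((- 1ℚ) ^ (s ∸ ℓ) * ℓ ^ᶻ (+ m -ᶻ + s)) /! (s ∸ ℓ)))
    /! n
theorem1 n k m _ _ k≤n = P-closed k (n ∸ k) m (ℕ.m+[n∸m]≡n k≤n) (ℕ.+-comm 1 (n ∸ k))
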